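{- Let $d$ be a positive integer and let $A \in \mathbb{R}^{[m]\times[n]}$. Suppose that for every vector $b\in\mathbb{R}^{[m]}$ the solution graph $G(R(A,b))$ is connected. If $m\le 3$ or $n\le 2$, then $A$ has an elimination ordering.
   Context: Fix a positive integer $d$ and let $D=\{0,1,\dots,d\}$; $[n]=\{1,\dots,n\}$. For $A\in\mathbb{R}^{[m]\times[n]}$ and $b\in\mathbb{R}^{[m]}$, $R(A,b)=\{x\in D^{[n]} : Ax\ge b\}$. For $R\subseteq D^{[n]}$, the solution graph $G(R)$ is the undirected graph with vertex set $R$ in which $x,y$ are adjacent iff they differ in exactly one coordinate. A matrix $A=(a_{ij})$ with column index set $J$ can be eliminated at column $j\in J$ if (i) for every row $i$ with $a_{ij}>0$ we have $a_{ij'}=0$ for all $j'\in J\setminus\{j\}$, or (ii) for every row $i$ with $a_{ij}<0$ we have $a_{ij'}=0$ for all $j'\in J\setminus\{j\}$. For $J'\subseteq[n]$, $\mathrm{elm}(A,J')$ is the submatrix of $A$ obtained by deleting the columns indexed by $J'$. A sequence $(j_1,\dots,j_n)$ of the elements of $[n]$ is an elimination ordering (EO) of $A$ if for every $t\in[n]$ the matrix $\mathrm{elm}(A,\{j_1,\dots,j_{t-1}\})$ can be eliminated at column $j_t$. -}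

module Defs where

open import Algebra.Bundles using (CommutativeMonoid)
import Algebra.Properties.CommutativeSemigroup as CommutativeSemigroupProperties
import Algebra.Properties.Ring as RingProperties
open import Data.Fin.Base using (Fin; toℕ) renaming (_<_ to _<ᶠ_)
open import Data.Fin.Permutation using (Permutation′; _⟨$⟩ʳ_; _⟨$⟩ˡ_; inverseˡ)
open import Data.Fin.Properties using (<⇒≢)
open import Data.Integer.Base using (+_)
open import Data.Irrelevant using ([_])
open import Data.Nat.Base as ℕ using (ℕ; suc)
import Data.Nat.Properties as ℕ
open import Data.Product.Base using (∃-syntax; _×_; _,_; proj₁; proj₂)
open import Data.Rational.Base as ℚ using (ℚ; 0ℚ; 1ℚ; ½; ∣_∣)
import Data.Rational.Properties as ℚ
open import Data.Refinement.Base as Refinement using (Refinement)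
open import Data.Sum.Base using (_⊎_)
open import Data.Vec.Base using (Vec; lookup)
open import Data.Vec.Functional using (Vector; foldr)
open import Level using (0ℓ)
open import Relation.Binary.Construct.Closure.ReflexiveTransitive using (Star)
open import Relation.Binary.Core using (Rel)
open import Relation.Binary.PropositionalEquality
  using (_≡_; _≢_; refl; sym; trans; cong; cong₂; subst)
open import Relation.Unary using (Pred; _∈_; _∉_)

Eventually : Pred ℕ 0ℓ → Set
Eventually P = ∃[ N ] ∀ n → N ℕ.≤ n → P n

IsCauchy : (ℕ → ℚ) → Set
IsCauchy s = ∀ ε → 0ℚ ℚ.< ε →
  ∃[ N ] ∀ m n → N ℕ.≤ m → N ℕ.≤ n → ∣ s m ℚ.- s n ∣ ℚ.< ε

-- Real numbers are Cauchy sequences of rationals, to be compared by _≈_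
-- rather than by propositional equality.
record ℝ : Set where
  constructor mkℝ
  field
    seq    : ℕ → ℚ
    cauchy : IsCauchy seq

open ℝ public

infix 4 _≈_ _≤_ _≥_ _<_ _>_

_≈_ _≤_ _≥_ _<_ _>_ : Rel ℝ 0ℓ
x ≈ y = ∀ ε → 0ℚ ℚ.< ε → Eventually λ n → ∣ seq x n ℚ.- seq y n ∣ ℚ.< ε
x ≤ y = ∀ ε → 0ℚ ℚ.< ε → Eventually λ n → seq x n ℚ.≤ seq y n ℚ.+ ε
x < y = ∃[ ε ] 0ℚ ℚ.< ε × Eventually λ n → seq x n ℚ.+ ε ℚ.≤ seq y n
x ≥ y = y ≤ x
x > y = y < x

fromℚ : ℚ → ℝ
fromℚ q = mkℝ (λ _ → q) λ ε 0<ε →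
  0 , λ _ _ _ _ → subst (ℚ._< ε) (sym (cong ∣_∣ (ℚ.+-inverseʳ q))) 0<ε

fromℕ : ℕ → ℝ
fromℕ k = fromℚ (+ k ℚ./ 1)

0ℝ : ℝ
0ℝ = fromℚ 0ℚ

private
  open CommutativeSemigroupProperties
    (CommutativeMonoid.commutativeSemigroup ℚ.+-0-commutativeMonoid)
    using (interchange)
  open RingProperties ℚ.+-*-ring using (x[y-z]≈xy-xz; [y-z]x≈yx-zx)

  split : ∀ p q → p ≡ (p ℚ.- q) ℚ.+ q
  split p q = sym (trans (ℚ.+-assoc p (ℚ.- q) q)
    (trans (cong (p ℚ.+_) (ℚ.+-inverseˡ q)) (ℚ.+-identityʳ p)))

  +-cauchy : ∀ s t → IsCauchy s → IsCauchy t → IsCauchy (λ n → s n ℚ.+ t n)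
  +-cauchy s t cs ct ε 0<ε = N₁ ℕ.⊔ N₂ , λ m n N≤m N≤n → begin-strict
      ∣ (s m ℚ.+ t m) ℚ.- (s n ℚ.+ t n) ∣
        ≡⟨ cong ∣_∣ (regroup (s m) (t m) (s n) (t n)) ⟩
      ∣ (s m ℚ.- s n) ℚ.+ (t m ℚ.- t n) ∣
        ≤⟨ ℚ.∣p+q∣≤∣p∣+∣q∣ (s m ℚ.- s n) (t m ℚ.- t n) ⟩
      ∣ s m ℚ.- s n ∣ ℚ.+ ∣ t m ℚ.- t n ∣
        <⟨ ℚ.+-mono-<
             (h₁ m n (ℕ.m⊔n≤o⇒m≤o N₁ N₂ N≤m) (ℕ.m⊔n≤o⇒m≤o N₁ N₂ N≤n))
             (h₂ m n (ℕ.m⊔n≤o⇒n≤o N₁ N₂ N≤m) (ℕ.m⊔n≤o⇒n≤o N₁ N₂ N≤n)) ⟩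
      ½ ℚ.* ε ℚ.+ ½ ℚ.* ε
        ≡⟨ trans (sym (ℚ.*-distribʳ-+ ε ½ ½)) (ℚ.*-identityˡ ε) ⟩
      ε ∎
    where
    open ℚ.≤-Reasoning
    0<½ε : 0ℚ ℚ.< ½ ℚ.* ε
    0<½ε = subst (ℚ._< ½ ℚ.* ε) (ℚ.*-zeroʳ ½) (ℚ.*-monoʳ-<-pos ½ 0<ε)
    N₁ = cs _ 0<½ε .proj₁
    h₁ = cs _ 0<½ε .proj₂
    N₂ = ct _ 0<½ε .proj₁
    h₂ = ct _ 0<½ε .proj₂
    regroup : ∀ a b c d →
      (a ℚ.+ b) ℚ.- (c ℚ.+ d) ≡ (a ℚ.- c) ℚ.+ (b ℚ.- d)
    regroup a b c d =
      trans (cong (a ℚ.+ b ℚ.+_) (ℚ.neg-distrib-+ c d))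
            (interchange a b (ℚ.- c) (ℚ.- d))

  eventually-bounded : ∀ s → IsCauchy s →
    ∃[ B ] 0ℚ ℚ.< B × Eventually λ n → ∣ s n ∣ ℚ.≤ B
  eventually-bounded s cs with cs 1ℚ (ℚ.positive⁻¹ 1ℚ)
  ... | N , h =
    1ℚ ℚ.+ ∣ s N ∣ ,
    ℚ.+-mono-<-≤ (ℚ.positive⁻¹ 1ℚ) (ℚ.0≤∣p∣ (s N)) ,
    N , λ n N≤n → begin
      ∣ s n ∣                       ≡⟨ cong ∣_∣ (split (s n) (s N)) ⟩
      ∣ (s n ℚ.- s N) ℚ.+ s N ∣     ≤⟨ ℚ.∣p+q∣≤∣p∣+∣q∣ (s n ℚ.- s N) (s N) ⟩
      ∣ s n ℚ.- s N ∣ ℚ.+ ∣ s N ∣   ≤⟨ ℚ.+-monoˡ-≤ ∣ s N ∣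
                                          (ℚ.<⇒≤ (h n N N≤n ℕ.≤-refl)) ⟩
      1ℚ ℚ.+ ∣ s N ∣                ∎
    where
    open ℚ.≤-Reasoning

  *-cauchy : ∀ s t → IsCauchy s → IsCauchy t → IsCauchy (λ n → s n ℚ.* t n)
  *-cauchy s t cs ct ε 0<ε
    with eventually-bounded s cs | eventually-bounded t ct
  ... | B , 0<B , K , bound-s | C , 0<C , L , bound-t =
    (K ℕ.⊔ L) ℕ.⊔ (N₁ ℕ.⊔ N₂) , λ m n N≤m N≤n →
      let K≤m  = ℕ.m⊔n≤o⇒m≤o K L (ℕ.m⊔n≤o⇒m≤o (K ℕ.⊔ L) (N₁ ℕ.⊔ N₂) N≤m)
          L≤n  = ℕ.m⊔n≤o⇒n≤o K L (ℕ.m⊔n≤o⇒m≤o (K ℕ.⊔ L) (N₁ ℕ.⊔ N₂) N≤n)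
          N′≤m = ℕ.m⊔n≤o⇒n≤o (K ℕ.⊔ L) (N₁ ℕ.⊔ N₂) N≤m
          N′≤n = ℕ.m⊔n≤o⇒n≤o (K ℕ.⊔ L) (N₁ ℕ.⊔ N₂) N≤n
          ds<δ = h₁ m n (ℕ.m⊔n≤o⇒m≤o N₁ N₂ N′≤m) (ℕ.m⊔n≤o⇒m≤o N₁ N₂ N′≤n)
          dt<δ = h₂ m n (ℕ.m⊔n≤o⇒n≤o N₁ N₂ N′≤m) (ℕ.m⊔n≤o⇒n≤o N₁ N₂ N′≤n)
          ds   = s m ℚ.- s n
          dt   = t m ℚ.- t n
      in begin-strict
      ∣ s m ℚ.* t m ℚ.- s n ℚ.* t n ∣
        ≡⟨ cong ∣_∣ (regroup (s m) (t m) (s n) (t n)) ⟩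
      ∣ s m ℚ.* dt ℚ.+ t n ℚ.* ds ∣
        ≤⟨ ℚ.∣p+q∣≤∣p∣+∣q∣ (s m ℚ.* dt) (t n ℚ.* ds) ⟩
      ∣ s m ℚ.* dt ∣ ℚ.+ ∣ t n ℚ.* ds ∣
        <⟨ ℚ.+-mono-< (product-bound (s m) dt 0<B (bound-s m K≤m) dt<δ)
                      (product-bound (t n) ds 0<C (bound-t n L≤n) ds<δ) ⟩
      B ℚ.* δ ℚ.+ C ℚ.* δ
        ≡⟨ sym (ℚ.*-distribʳ-+ δ B C) ⟩
      (B ℚ.+ C) ℚ.* δ
        ≡⟨ sym (ℚ.*-assoc (B ℚ.+ C) (ℚ.1/ (B ℚ.+ C)) ε) ⟩
      (B ℚ.+ C) ℚ.* ℚ.1/ (B ℚ.+ C) ℚ.* ε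
        ≡⟨ trans (cong (ℚ._* ε) (ℚ.*-inverseʳ (B ℚ.+ C))) (ℚ.*-identityˡ ε) ⟩
      ε ∎
    where
    open ℚ.≤-Reasoning
    instance
      B+C-pos : ℚ.Positive (B ℚ.+ C)
      B+C-pos = ℚ.positive (ℚ.+-mono-< 0<B 0<C)
      B+C-nonZero : ℚ.NonZero (B ℚ.+ C)
      B+C-nonZero = ℚ.pos⇒nonZero (B ℚ.+ C)
      1/-pos : ℚ.Positive (ℚ.1/ (B ℚ.+ C))
      1/-pos = ℚ.1/pos⇒pos (B ℚ.+ C)
    δ : ℚ
    δ = ℚ.1/ (B ℚ.+ C) ℚ.* ε
    0<δ : 0ℚ ℚ.< δ
    0<δ = subst (ℚ._< δ) (ℚ.*-zeroʳ (ℚ.1/ (B ℚ.+ C)))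
            (ℚ.*-monoʳ-<-pos (ℚ.1/ (B ℚ.+ C)) 0<ε)
    N₁ = cs δ 0<δ .proj₁
    h₁ = cs δ 0<δ .proj₂
    N₂ = ct δ 0<δ .proj₁
    h₂ = ct δ 0<δ .proj₂
    product-bound : ∀ {D} p q → 0ℚ ℚ.< D → ∣ p ∣ ℚ.≤ D → ∣ q ∣ ℚ.< δ →
      ∣ p ℚ.* q ∣ ℚ.< D ℚ.* δ
    product-bound {D} p q 0<D p≤D q<δ = begin-strict
      ∣ p ℚ.* q ∣      ≡⟨ ℚ.∣p*q∣≡∣p∣*∣q∣ p q ⟩
      ∣ p ∣ ℚ.* ∣ q ∣  ≤⟨ ℚ.*-monoʳ-≤-nonNeg ∣ q ∣ {{ℚ.∣-∣-nonNeg q}} p≤D ⟩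
      D ℚ.* ∣ q ∣      <⟨ ℚ.*-monoʳ-<-pos D {{ℚ.positive 0<D}} q<δ ⟩
      D ℚ.* δ          ∎
    regroup : ∀ a b c d →
      a ℚ.* b ℚ.- c ℚ.* d ≡ a ℚ.* (b ℚ.- d) ℚ.+ d ℚ.* (a ℚ.- c)
    regroup a b c d = begin-equality
      a ℚ.* b ℚ.- c ℚ.* d
        ≡⟨ cong (ℚ._- c ℚ.* d) (split (a ℚ.* b) (a ℚ.* d)) ⟩
      (a ℚ.* b ℚ.- a ℚ.* d) ℚ.+ a ℚ.* d ℚ.- c ℚ.* d
        ≡⟨ ℚ.+-assoc (a ℚ.* b ℚ.- a ℚ.* d) (a ℚ.* d) (ℚ.- (c ℚ.* d)) ⟩
      (a ℚ.* b ℚ.- a ℚ.* d) ℚ.+ (a ℚ.* d ℚ.- c ℚ.* d)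
        ≡⟨ cong₂ ℚ._+_ (sym (x[y-z]≈xy-xz a b d)) (sym ([y-z]x≈yx-zx d a c)) ⟩
      a ℚ.* (b ℚ.- d) ℚ.+ (a ℚ.- c) ℚ.* d
        ≡⟨ cong (a ℚ.* (b ℚ.- d) ℚ.+_) (ℚ.*-comm (a ℚ.- c) d) ⟩
      a ℚ.* (b ℚ.- d) ℚ.+ d ℚ.* (a ℚ.- c) ∎

infixl 6 _+_
infixl 7 _*_

_+_ _*_ : ℝ → ℝ → ℝ
x + y = mkℝ (λ n → seq x n ℚ.+ seq y n) (+-cauchy (seq x) (seq y) (cauchy x) (cauchy y))
x * y = mkℝ (λ n → seq x n ℚ.* seq y n) (*-cauchy (seq x) (seq y) (cauchy x) (cauchy y))

sum : ∀ {n} → Vector ℝ n → ℝ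
sum = foldr _+_ 0ℝ

-- Columns are indexed by an arbitrary type, so that deleting columns
-- again gives a matrix.
Matrix : ℕ → Set → Set
Matrix m J = Fin m → J → ℝ

-- Dⁿ with D = {0, …, d}.
Point : ℕ → ℕ → Set
Point d n = Vec (Fin (suc d)) n

_·_ : ∀ {d m n} → Matrix m (Fin n) → Point d n → Vector ℝ m
(A · x) i = sum λ j → A i j * fromℕ (toℕ (lookup x j))

Solutions : ∀ d {m n} → Matrix m (Fin n) → Vector ℝ m → Pred (Point d n) 0ℓ
Solutions d A b x = ∀ i → (A · x) i ≥ b i

DifferInOne : ∀ {d n} → Rel (Point d n) 0ℓ
DifferInOne x y = ∃[ j ] lookup x j ≢ lookup y j
                       × (∀ k → k ≢ j → lookup x k ≡ lookup y k)

-- The edges of G(R), as a relation on the ambient Dⁿ.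
Adjacent : ∀ {d n} → Pred (Point d n) 0ℓ → Rel (Point d n) 0ℓ
Adjacent R x y = x ∈ R × y ∈ R × DifferInOne x y

-- The empty graph counts as connected.
Connected : ∀ {d n} → Pred (Point d n) 0ℓ → Set
Connected R = ∀ x y → x ∈ R → y ∈ R → Star (Adjacent R) x y

CanBeEliminatedAt : ∀ {m J} → Matrix m J → J → Set
CanBeEliminatedAt A j =
    (∀ i → A i j > 0ℝ → ∀ j′ → j′ ≢ j → A i j′ ≈ 0ℝ)
  ⊎ (∀ i → A i j < 0ℝ → ∀ j′ → j′ ≢ j → A i j′ ≈ 0ℝ)

-- The membership proofs are irrelevant, so equality of remaining columns
-- is equality of their indices.
Remaining : ∀ {n} → Pred (Fin n) 0ℓ → Set
Remaining {n} J′ = Refinement (Fin n) (_∉ J′)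

elm : ∀ {m n} → Matrix m (Fin n) → (J′ : Pred (Fin n) 0ℓ) →
      Matrix m (Remaining J′)
elm A J′ i j = A i (Refinement.value j)

-- The sequence (j₁, …, jₙ) is a permutation σ of the column indices.
Before : ∀ {n} → Permutation′ n → Fin n → Pred (Fin n) 0ℓ
Before σ t j = ∃[ s ] s <ᶠ t × σ ⟨$⟩ʳ s ≡ j

current : ∀ {n} (σ : Permutation′ n) (t : Fin n) → Remaining (Before σ t)
current σ t = σ ⟨$⟩ʳ t Refinement., [ notBefore ]
  where
  notBefore : σ ⟨$⟩ʳ t ∉ Before σ t
  notBefore (s , s<t , σs≡σt) = <⇒≢ s<t
    (trans (sym (inverseˡ σ))
           (trans (cong (σ ⟨$⟩ˡ_) σs≡σt) (inverseˡ σ)))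

IsEliminationOrdering : ∀ {m n} → Matrix m (Fin n) → Permutation′ n → Set
IsEliminationOrdering A σ =
  ∀ t → CanBeEliminatedAt (elm A (Before σ t)) (current σ t)

HasEliminationOrdering : ∀ {m n} → Matrix m (Fin n) → Set
HasEliminationOrdering A = ∃[ σ ] IsEliminationOrdering A σ

{-# OPTIONS --safe #-}

-- Eliminating an eliminable column keeps all solution graphs connected, because
-- the eliminated variable has an optimal value. So it suffices to refute a
-- connected matrix A with at least one column and no eliminable column. To do
-- so, choose a corner c of the box and a set S of columns, and let y arise
-- from c by one step inwards along each column in S. For b = min (A c) (A y),
-- the corner c is an isolated vertex if each column l has a blocking row i:
-- with columns oriented inwards, A i l is negative and smaller than the sum of
-- A i over S.
--
-- If two rows have opposite signs in each of two columns j and k, then a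
-- suitable choice of the two columns and of the blocking rows, with S = {j, k},
-- works. For n ≤ 2 there are always two such rows. For three rows every column
-- has opposite signs in some pair of rows, so if no pair occurs twice and
-- n ≥ 3, then A is 3 × 3 with a cyclic sign pattern, and S = all columns works.
module Submission where

import Algebra.Properties.CommutativeMonoid.Sum as Sum
open import Axiom.ExcludedMiddle using (ExcludedMiddle)
open import Data.Bool.Base using (Bool; true; false; not; if_then_else_)
open import Data.Empty using (⊥; ⊥-elim)
import Data.Empty.Irrelevant as Irrelevant
open import Data.Fin.Base using (Fin; zero; suc; toℕ; punchIn; punchOut; inject₁)
import Data.Fin.Base as Fin using (fromℕ)
open import Data.Fin.Permutation as Perm using (_⟨$⟩ʳ_)
open import Data.Fin.Properties as Fin using (_≟_)
open import Data.Integer.Base as ℤ using (+_)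
import Data.Integer.Properties as ℤ
open import Data.Irrelevant using ([_])
open import Data.List.Base as List using (List; []; _∷_)
open import Data.List.Relation.Unary.All as All using (All)
import Data.List.Relation.Unary.AllPairs.Core as AllPairs
open import Data.List.Relation.Unary.Unique.Propositional using (Unique)
open import Data.Nat.Base as ℕ using (ℕ; zero; suc; NonZero; _≤_; s≤s; z≤n)
import Data.Nat.Properties as ℕ
open import Data.Product.Base using (∃-syntax; _×_; _,_; proj₁; proj₂)
open import Data.Rational.Base as ℚ using (ℚ; 0ℚ; 1ℚ; ½)
import Data.Rational.Properties as ℚ
open import Data.Rational.Solver using (module +-*-Solver)
import Data.Rational.Unnormalised.Base as ℚᵘ
import Data.Rational.Unnormalised.Properties as ℚᵘ
open import Data.Refinement.Base using (value; _,_)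
open import Data.Sum.Base using (_⊎_; inj₁; inj₂; [_,_]′)
open import Data.Vec.Base
  using (Vec; []; _∷_; lookup; _[_]≔_; insertAt; removeAt; tabulate)
open import Data.Vec.Functional using (Vector)
open import Data.Vec.Properties
  using (lookup∘tabulate; lookup∘update; lookup∘update′; insertAt-lookup;
         insertAt-punchIn; removeAt-insertAt; insertAt-removeAt)
open import Data.Vec.Relation.Binary.Pointwise.Extensional using (ext; Pointwise-≡⇒≡)
open import Level using (0ℓ)
open import Relation.Binary.Construct.Closure.ReflexiveTransitive
  using (Star; _◅_; kleisliStar) renaming (ε to nil)
open import Relation.Binary.PropositionalEquality
open import Relation.Nullary using (Dec; ¬_; yes; no; does)
open import Relation.Nullary.Decidable using (dec-true; dec-false; decidable-stable)
open import Relation.Unary using (_∈_; _∉_)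
open import Defs hiding (_≤_)
open import Defs using () renaming (_≤_ to _≤ᴿ_)
open +-*-Solver using (solve; con; _:=_; _:+_; _:*_; _:-_; :-_)
module ∑ = Sum ℚ.+-0-commutativeMonoid

-- Arithmetic and order of the Cauchy reals

both : ∀ {P Q} → Eventually P → Eventually Q → Eventually λ n → P n × Q n
both (M , p) (N , q) = M ℕ.⊔ N , λ n le →
  p n (ℕ.m⊔n≤o⇒m≤o M N le) , q n (ℕ.m⊔n≤o⇒n≤o M N le)

eventually-map : ∀ {P Q} → (∀ n → P n → Q n) → Eventually P → Eventually Q
eventually-map f (N , p) = N , λ n le → f n (p n le)

*-pos : ∀ {p q} → 0ℚ ℚ.< p → 0ℚ ℚ.< q → 0ℚ ℚ.< p ℚ.* q
*-pos {p} {q} 0<p 0<q =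
  subst (ℚ._< p ℚ.* q) (ℚ.*-zeroʳ p) (ℚ.*-monoʳ-<-pos p {{ℚ.positive 0<p}} 0<q)

half-pos : ∀ {ε} → 0ℚ ℚ.< ε → 0ℚ ℚ.< ½ ℚ.* ε
half-pos = *-pos (ℚ.positive⁻¹ ½)

p≤∣p∣ : ∀ p → p ℚ.≤ ℚ.∣ p ∣
p≤∣p∣ p with ℚ.≤-total 0ℚ p
... | inj₁ 0≤p = ℚ.≤-reflexive (sym (ℚ.0≤p⇒∣p∣≡p 0≤p))
... | inj₂ p≤0 = ℚ.≤-trans p≤0 (ℚ.0≤∣p∣ p)

∣p-q∣<ε⇒p≤q+ε : ∀ p q {ε} → ℚ.∣ p ℚ.- q ∣ ℚ.< ε → p ℚ.≤ q ℚ.+ ε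
∣p-q∣<ε⇒p≤q+ε p q {ε} lt = begin
  p                  ≡⟨ solve 2 (λ p q → p := q :+ (p :- q)) refl p q ⟩
  q ℚ.+ (p ℚ.- q)    ≤⟨ ℚ.+-monoʳ-≤ q (ℚ.≤-trans (p≤∣p∣ (p ℚ.- q)) (ℚ.<⇒≤ lt)) ⟩
  q ℚ.+ ε            ∎
  where open ℚ.≤-Reasoning

neg-difference : ∀ p q → ℚ.- (p ℚ.- q) ≡ q ℚ.- p
neg-difference = solve 2 (λ p q → :- (p :- q) := q :- p) refl

∣p-q∣<ε⇒q≤p+ε : ∀ p q {ε} → ℚ.∣ p ℚ.- q ∣ ℚ.< ε → q ℚ.≤ p ℚ.+ ε
∣p-q∣<ε⇒q≤p+ε p q lt = ∣p-q∣<ε⇒p≤q+ε q p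
  (subst (ℚ._< _) (trans (sym (ℚ.∣-p∣≡∣p∣ (p ℚ.- q)))
    (cong ℚ.∣_∣ (neg-difference p q))) lt)

≈⇒≤ : ∀ {x y} → x ≈ y → x ≤ᴿ y
≈⇒≤ {x} {y} x≈y ε 0<ε =
  eventually-map (λ n → ∣p-q∣<ε⇒p≤q+ε (seq x n) (seq y n)) (x≈y ε 0<ε)

≈⇒≥ : ∀ {x y} → x ≈ y → y ≤ᴿ x
≈⇒≥ {x} {y} x≈y ε 0<ε =
  eventually-map (λ n → ∣p-q∣<ε⇒q≤p+ε (seq x n) (seq y n)) (x≈y ε 0<ε)

p≤p+ε : ∀ p {ε} → 0ℚ ℚ.< ε → p ℚ.≤ p ℚ.+ ε
p≤p+ε p {ε} 0<ε = subst (ℚ._≤ p ℚ.+ ε) (ℚ.+-identityʳ p) (ℚ.+-monoʳ-≤ p (ℚ.<⇒≤ 0<ε))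

pointwise⇒≤ : ∀ {x y} → (∀ n → seq x n ℚ.≤ seq y n) → x ≤ᴿ y
pointwise⇒≤ {y = y} le ε 0<ε = 0 , λ n _ → ℚ.≤-trans (le n) (p≤p+ε (seq y n) 0<ε)

≤-refl : ∀ {x} → x ≤ᴿ x
≤-refl {x} = pointwise⇒≤ {x} {x} λ n → ℚ.≤-refl

<⇒≤ : ∀ {x y} → x < y → x ≤ᴿ y
<⇒≤ {x} {y} (ε , 0<ε , N , h) δ 0<δ = N , λ n le →
  ℚ.≤-trans (p≤p+ε (seq x n) 0<ε) (ℚ.≤-trans (h n le) (p≤p+ε (seq y n) 0<δ))

cancelʳ : ∀ p h → (p ℚ.+ h) ℚ.- h ≡ p
cancelʳ = solve 2 (λ p h → (p :+ h) :- h := p) refl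

cancelˡ : ∀ p h → (p ℚ.+ h) ℚ.- p ≡ h
cancelˡ = solve 2 (λ p h → (p :+ h) :- p := h) refl

0-p≡-1*p : ∀ p → 0ℚ ℚ.- p ≡ ℚ.- 1ℚ ℚ.* p
0-p≡-1*p = solve 1 (λ p → con 0ℚ :- p := con (ℚ.- 1ℚ) :* p) refl

two-halves : ∀ p ε → p ℚ.+ ½ ℚ.* ε ℚ.+ ½ ℚ.* ε ≡ p ℚ.+ ε
two-halves = solve 2 (λ p ε → p :+ con ½ :* ε :+ con ½ :* ε := p :+ ε) refl

≤-trans : ∀ {x y z} → x ≤ᴿ y → y ≤ᴿ z → x ≤ᴿ z
≤-trans {x} {y} {z} x≤y y≤z ε 0<ε =
  eventually-map
    (λ n (p , q) → subst (seq x n ℚ.≤_) (two-halves (seq z n) ε)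
      (ℚ.≤-trans p (ℚ.+-monoˡ-≤ (½ ℚ.* ε) q)))
    (both (x≤y _ (half-pos 0<ε)) (y≤z _ (half-pos 0<ε)))

≤-<-trans : ∀ {x y z} → x ≤ᴿ y → y < z → x < z
≤-<-trans {x} {y} {z} x≤y (ε , 0<ε , y<z) = ½ ℚ.* ε , half-pos 0<ε ,
  eventually-map
    (λ n (p , q) → ℚ.≤-trans (ℚ.+-monoˡ-≤ (½ ℚ.* ε) p)
      (subst (ℚ._≤ seq z n) (sym (two-halves (seq y n) ε)) q))
    (both (x≤y _ (half-pos 0<ε)) y<z)

<-≤-trans : ∀ {x y z} → x < y → y ≤ᴿ z → x < z
<-≤-trans {x} {y} {z} (ε , 0<ε , x<y) y≤z = ½ ℚ.* ε , half-pos 0<ε ,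
  eventually-map
    (λ n (p , q) → let open ℚ.≤-Reasoning in begin
      seq x n ℚ.+ ½ ℚ.* ε
        ≡⟨ regroup (seq x n) ε ⟩
      (seq x n ℚ.+ ε) ℚ.- ½ ℚ.* ε           ≤⟨ ℚ.+-monoˡ-≤ (ℚ.- (½ ℚ.* ε)) (ℚ.≤-trans p q) ⟩
      (seq z n ℚ.+ ½ ℚ.* ε) ℚ.- ½ ℚ.* ε
        ≡⟨ cancelʳ (seq z n) (½ ℚ.* ε) ⟩
      seq z n                                ∎)
    (both x<y (y≤z _ (half-pos 0<ε)))
  where
  regroup : ∀ p ε → p ℚ.+ ½ ℚ.* ε ≡ (p ℚ.+ ε) ℚ.- ½ ℚ.* ε
  regroup = solve 2 (λ p ε → p :+ con ½ :* ε := (p :+ ε) :- con ½ :* ε) refl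

<-irrefl : ∀ {x} → ¬ x < x
<-irrefl {x} (ε , 0<ε , N , h) = ℚ.<-irrefl refl (ℚ.<-≤-trans
  (subst (ℚ._< seq x N ℚ.+ ε) (ℚ.+-identityʳ (seq x N)) (ℚ.+-monoʳ-< (seq x N) 0<ε))
  (h N ℕ.≤-refl))

<⇒≱ : ∀ {x y} → x < y → ¬ y ≤ᴿ x
<⇒≱ {x} {y} x<y y≤x = <-irrefl {x} (<-≤-trans {x} {y} {x} x<y y≤x)

-- One rational comparison at an index `K`, past which both sequences stay within ε/8 of their
-- `K`-th terms, decides the matter: a gap above ε/2 at `K` would leave a gap of ε/4 from then on,
-- so that `x < y`.
≮⇒≥ : ∀ {x y} → ¬ x < y → y ≤ᴿ x
≮⇒≥ {x} {y} x≮y ε 0<ε = go (seq y K ℚ.≤? seq x K ℚ.+ ½ ℚ.* ε)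
  where
  open ℚ.≤-Reasoning
  δ = ½ ℚ.* (½ ℚ.* (½ ℚ.* ε))
  0<δ : 0ℚ ℚ.< δ
  0<δ = half-pos (half-pos (half-pos 0<ε))
  M = cauchy x δ 0<δ .proj₁
  hx = cauchy x δ 0<δ .proj₂
  N = cauchy y δ 0<δ .proj₁
  hy = cauchy y δ 0<δ .proj₂
  K = M ℕ.⊔ N
  regroup₁ : ∀ p ε → let δ = ½ ℚ.* (½ ℚ.* (½ ℚ.* ε)) in
    p ℚ.+ δ ℚ.+ ½ ℚ.* ε ℚ.+ δ ℚ.+ ½ ℚ.* (½ ℚ.* ε) ≡ p ℚ.+ ε
  regroup₁ = solve 2 (λ p ε → let δ = con ½ :* (con ½ :* (con ½ :* ε)) in
    p :+ δ :+ con ½ :* ε :+ δ :+ con ½ :* (con ½ :* ε) := p :+ ε) refl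
  regroup₂ : ∀ p ε → let δ = ½ ℚ.* (½ ℚ.* (½ ℚ.* ε)) in
    p ℚ.+ δ ℚ.+ ½ ℚ.* (½ ℚ.* ε) ≡ (p ℚ.+ ½ ℚ.* ε) ℚ.- δ
  regroup₂ = solve 2 (λ p ε → let δ = con ½ :* (con ½ :* (con ½ :* ε)) in
    p :+ δ :+ con ½ :* (con ½ :* ε) := (p :+ con ½ :* ε) :- δ) refl
  module _ n (K≤n : K ≤ n) where
    dx : ℚ.∣ seq x n ℚ.- seq x K ∣ ℚ.< δ
    dx = hx n K (ℕ.m⊔n≤o⇒m≤o M N K≤n) (ℕ.m≤m⊔n M N)
    dy : ℚ.∣ seq y n ℚ.- seq y K ∣ ℚ.< δ
    dy = hy n K (ℕ.m⊔n≤o⇒n≤o M N K≤n) (ℕ.m≤n⊔m M N)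
  go : Dec (seq y K ℚ.≤ seq x K ℚ.+ ½ ℚ.* ε) → Eventually λ n → seq y n ℚ.≤ seq x n ℚ.+ ε
  go (yes le) = K , λ n K≤n → begin
    seq y n                                      ≤⟨ ∣p-q∣<ε⇒p≤q+ε (seq y n) (seq y K) (dy n K≤n) ⟩
    seq y K ℚ.+ δ                                ≤⟨ ℚ.+-monoˡ-≤ δ le ⟩
    seq x K ℚ.+ ½ ℚ.* ε ℚ.+ δ
      ≤⟨ ℚ.+-monoˡ-≤ δ (ℚ.+-monoˡ-≤ (½ ℚ.* ε) (∣p-q∣<ε⇒q≤p+ε (seq x n) (seq x K) (dx n K≤n))) ⟩
    seq x n ℚ.+ δ ℚ.+ ½ ℚ.* ε ℚ.+ δ
      ≤⟨ p≤p+ε _ (half-pos (half-pos 0<ε)) ⟩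
    seq x n ℚ.+ δ ℚ.+ ½ ℚ.* ε ℚ.+ δ ℚ.+ ½ ℚ.* (½ ℚ.* ε)
      ≡⟨ regroup₁ (seq x n) ε ⟩
    seq x n ℚ.+ ε                                ∎
  go (no ¬le) = ⊥-elim (x≮y (½ ℚ.* (½ ℚ.* ε) , half-pos (half-pos 0<ε) , K , λ n K≤n → begin
    seq x n ℚ.+ ½ ℚ.* (½ ℚ.* ε)
      ≤⟨ ℚ.+-monoˡ-≤ _ (∣p-q∣<ε⇒p≤q+ε (seq x n) (seq x K) (dx n K≤n)) ⟩
    seq x K ℚ.+ δ ℚ.+ ½ ℚ.* (½ ℚ.* ε)
      ≡⟨ regroup₂ (seq x K) ε ⟩
    (seq x K ℚ.+ ½ ℚ.* ε) ℚ.- δ                  ≤⟨ ℚ.+-monoˡ-≤ (ℚ.- δ) (ℚ.<⇒≤ (ℚ.≰⇒> ¬le)) ⟩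
    seq y K ℚ.- δ
      ≤⟨ ℚ.+-monoˡ-≤ (ℚ.- δ) (∣p-q∣<ε⇒q≤p+ε (seq y n) (seq y K) (dy n K≤n)) ⟩
    (seq y n ℚ.+ δ) ℚ.- δ
      ≡⟨ cancelʳ (seq y n) δ ⟩
    seq y n                                      ∎))

≤-antisym : ∀ {x y} → x ≤ᴿ y → y ≤ᴿ x → x ≈ y
≤-antisym {x} {y} x≤y y≤x ε 0<ε =
  eventually-map (λ n (p , q) → ℚ.≤-<-trans (bound (seq x n) (seq y n) p q) ½ε<ε)
    (both (x≤y _ (half-pos 0<ε)) (y≤x _ (half-pos 0<ε)))
  where
  open ℚ.≤-Reasoning
  ½ε<ε : ½ ℚ.* ε ℚ.< ε
  ½ε<ε = subst₂ ℚ._<_ (ℚ.+-identityʳ (½ ℚ.* ε)) (halves ε)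
    (ℚ.+-monoʳ-< (½ ℚ.* ε) (half-pos 0<ε))
    where
    halves : ∀ ε → ½ ℚ.* ε ℚ.+ ½ ℚ.* ε ≡ ε
    halves = solve 1 (λ ε → con ½ :* ε :+ con ½ :* ε := ε) refl
  difference : ∀ p q → p ℚ.≤ q ℚ.+ ½ ℚ.* ε → p ℚ.- q ℚ.≤ ½ ℚ.* ε
  difference p q le = begin
    p ℚ.- q                     ≤⟨ ℚ.+-monoˡ-≤ (ℚ.- q) le ⟩
    (q ℚ.+ ½ ℚ.* ε) ℚ.- q       ≡⟨ cancelˡ q (½ ℚ.* ε) ⟩
    ½ ℚ.* ε                     ∎
  bound : ∀ p q → p ℚ.≤ q ℚ.+ ½ ℚ.* ε → q ℚ.≤ p ℚ.+ ½ ℚ.* ε → ℚ.∣ p ℚ.- q ∣ ℚ.≤ ½ ℚ.* ε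
  bound p q p≤ q≤ with ℚ.∣p∣≡p∨∣p∣≡-p (p ℚ.- q)
  ... | inj₁ eq = subst (ℚ._≤ ½ ℚ.* ε) (sym eq) (difference p q p≤)
  ... | inj₂ eq = subst (ℚ._≤ ½ ℚ.* ε)
    (sym (trans eq (neg-difference p q))) (difference q p q≤)

+-mono-≤ : ∀ {x y u v} → x ≤ᴿ y → u ≤ᴿ v → x + u ≤ᴿ y + v
+-mono-≤ {x} {y} {u} {v} x≤y u≤v ε 0<ε =
  eventually-map
    (λ n (p , q) → subst (seq x n ℚ.+ seq u n ℚ.≤_)
      (regroup (seq y n) (seq v n) ε)
      (ℚ.+-mono-≤ p q))
    (both (x≤y _ (half-pos 0<ε)) (u≤v _ (half-pos 0<ε)))
  where
  regroup : ∀ p q ε → (p ℚ.+ ½ ℚ.* ε) ℚ.+ (q ℚ.+ ½ ℚ.* ε) ≡ (p ℚ.+ q) ℚ.+ ε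
  regroup = solve 3 (λ p q ε → (p :+ con ½ :* ε) :+ (q :+ con ½ :* ε) := (p :+ q) :+ ε) refl

-- With ε scaled by 1/(q+1), the case q = 0 needs no special treatment.
*-monoʳ-≤ : ∀ {x y q} → 0ℚ ℚ.≤ q → x ≤ᴿ y → x * fromℚ q ≤ᴿ y * fromℚ q
*-monoʳ-≤ {x} {y} {q} 0≤q x≤y ε 0<ε =
  eventually-map (λ n p → begin
      seq x n ℚ.* q                        ≤⟨ ℚ.*-monoʳ-≤-nonNeg q {{ℚ.nonNegative 0≤q}} p ⟩
      (seq y n ℚ.+ r ℚ.* ε) ℚ.* q
        ≡⟨ regroup (seq y n) r ε q ⟩
      (seq y n ℚ.* q ℚ.+ (q ℚ.+ 1ℚ) ℚ.* r ℚ.* ε) ℚ.- r ℚ.* ε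
        ≡⟨ cong (λ u → (seq y n ℚ.* q ℚ.+ u ℚ.* ε) ℚ.- r ℚ.* ε) (ℚ.*-inverseʳ (q ℚ.+ 1ℚ)) ⟩
      (seq y n ℚ.* q ℚ.+ 1ℚ ℚ.* ε) ℚ.- r ℚ.* ε
        ≡⟨ cong (λ u → (seq y n ℚ.* q ℚ.+ u) ℚ.- r ℚ.* ε) (ℚ.*-identityˡ ε) ⟩
      (seq y n ℚ.* q ℚ.+ ε) ℚ.- r ℚ.* ε
        ≤⟨ ℚ.+-monoʳ-≤ (seq y n ℚ.* q ℚ.+ ε) (ℚ.neg-antimono-≤ (ℚ.<⇒≤ 0<rε)) ⟩
      (seq y n ℚ.* q ℚ.+ ε) ℚ.+ 0ℚ         ≡⟨ ℚ.+-identityʳ (seq y n ℚ.* q ℚ.+ ε) ⟩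
      seq y n ℚ.* q ℚ.+ ε                  ∎)
    (x≤y (r ℚ.* ε) 0<rε)
  where
  open ℚ.≤-Reasoning
  instance
    q+1-pos : ℚ.Positive (q ℚ.+ 1ℚ)
    q+1-pos = ℚ.positive (ℚ.+-mono-≤-< 0≤q (ℚ.positive⁻¹ 1ℚ))
    q+1-nonZero : ℚ.NonZero (q ℚ.+ 1ℚ)
    q+1-nonZero = ℚ.pos⇒nonZero (q ℚ.+ 1ℚ)
    1/-pos : ℚ.Positive (ℚ.1/ (q ℚ.+ 1ℚ))
    1/-pos = ℚ.1/pos⇒pos (q ℚ.+ 1ℚ)
  r = ℚ.1/ (q ℚ.+ 1ℚ)
  0<rε : 0ℚ ℚ.< r ℚ.* ε
  0<rε = *-pos (ℚ.positive⁻¹ r) 0<ε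
  regroup : ∀ y r ε q →
    (y ℚ.+ r ℚ.* ε) ℚ.* q ≡ (y ℚ.* q ℚ.+ (q ℚ.+ 1ℚ) ℚ.* r ℚ.* ε) ℚ.- r ℚ.* ε
  regroup = solve 4 (λ y r ε q →
    (y :+ r :* ε) :* q := (y :* q :+ (q :+ con 1ℚ) :* r :* ε) :- r :* ε) refl

-- Stated for s instead of x + (y + z), so that the summands may come in any order.
<-absorb : ∀ {x y z s} → (∀ n → seq s n ≡ seq x n ℚ.+ (seq y n ℚ.+ seq z n)) →
  0ℝ ≤ᴿ y → 0ℝ < z → x < s
<-absorb {x} {y} {z} {s} s≡ 0≤y (ε , 0<ε , h) = ½ ℚ.* ε , half-pos 0<ε ,
  eventually-map (λ n (p , q) → begin
      seq x n ℚ.+ ½ ℚ.* ε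
        ≡⟨ regroup₁ (seq x n) ε ⟩
      seq x n ℚ.+ (0ℚ ℚ.+ (0ℚ ℚ.+ ε) ℚ.- ½ ℚ.* ε)
        ≤⟨ ℚ.+-monoʳ-≤ (seq x n) (ℚ.+-monoˡ-≤ (ℚ.- (½ ℚ.* ε)) (ℚ.+-mono-≤ p q)) ⟩
      seq x n ℚ.+ ((seq y n ℚ.+ ½ ℚ.* ε) ℚ.+ seq z n ℚ.- ½ ℚ.* ε)
        ≡⟨ regroup₂ (seq x n) (seq y n) (seq z n) (½ ℚ.* ε) ⟩
      seq x n ℚ.+ (seq y n ℚ.+ seq z n)   ≡⟨ s≡ n ⟨
      seq s n                             ∎)
    (both (0≤y _ (half-pos 0<ε)) h)
  where
  open ℚ.≤-Reasoning
  regroup₁ : ∀ p ε → p ℚ.+ ½ ℚ.* ε ≡ p ℚ.+ (0ℚ ℚ.+ (0ℚ ℚ.+ ε) ℚ.- ½ ℚ.* ε)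
  regroup₁ = solve 2 (λ p ε →
    p :+ con ½ :* ε := p :+ (con 0ℚ :+ (con 0ℚ :+ ε) :- con ½ :* ε)) refl
  regroup₂ : ∀ x y z h → x ℚ.+ ((y ℚ.+ h) ℚ.+ z ℚ.- h) ≡ x ℚ.+ (y ℚ.+ z)
  regroup₂ = solve 4 (λ x y z h → x :+ ((y :+ h) :+ z :- h) := x :+ (y :+ z)) refl

<-resp : ∀ {x y x′ y′} → (∀ n → seq x n ≡ seq x′ n) → (∀ n → seq y n ≡ seq y′ n) → x < y → x′ < y′
<-resp ex ey (ε , 0<ε , h) = ε , 0<ε ,
  eventually-map (λ n → subst₂ (λ p q → p ℚ.+ ε ℚ.≤ q) (ex n) (ey n)) h

-- true stands for the sign +, false for −.
sign : Bool → ℚ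
sign true  = 1ℚ
sign false = ℚ.- 1ℚ

signed : Bool → ℝ → ℝ
signed s x = fromℚ (sign s) * x

data Opposite (x y : ℝ) : Set where
  -+ : x < 0ℝ → 0ℝ < y → Opposite x y
  +- : 0ℝ < x → y < 0ℝ → Opposite x y

neg-pos⇒neg : ∀ {x} → 0ℝ < x → signed false x < 0ℝ
neg-pos⇒neg {x} (ε , 0<ε , h) = ε , 0<ε , eventually-map (λ n p → begin
    ℚ.- 1ℚ ℚ.* seq x n ℚ.+ ε          ≡⟨ regroup (seq x n) ε ⟩
    (0ℚ ℚ.+ ε) ℚ.- seq x n            ≤⟨ ℚ.+-monoˡ-≤ (ℚ.- seq x n) p ⟩
    seq x n ℚ.- seq x n               ≡⟨ ℚ.+-inverseʳ (seq x n) ⟩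
    0ℚ                                ∎) h
  where
  open ℚ.≤-Reasoning
  regroup : ∀ p ε → ℚ.- 1ℚ ℚ.* p ℚ.+ ε ≡ (0ℚ ℚ.+ ε) ℚ.- p
  regroup = solve 2 (λ p ε → con (ℚ.- 1ℚ) :* p :+ ε := (con 0ℚ :+ ε) :- p) refl

neg-neg⇒pos : ∀ {x} → x < 0ℝ → 0ℝ < signed false x
neg-neg⇒pos {x} (ε , 0<ε , h) = ε , 0<ε , eventually-map (λ n p → begin
    0ℚ ℚ.+ ε                          ≡⟨ ℚ.+-identityˡ ε ⟩
    ε                                 ≡⟨ cancelˡ (seq x n) ε ⟨
    (seq x n ℚ.+ ε) ℚ.- seq x n       ≤⟨ ℚ.+-monoˡ-≤ (ℚ.- seq x n) p ⟩
    0ℚ ℚ.- seq x n                    ≡⟨ 0-p≡-1*p (seq x n) ⟩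
    ℚ.- 1ℚ ℚ.* seq x n                ∎) h
  where open ℚ.≤-Reasoning

0≤neg : ∀ {x} → x ≤ᴿ 0ℝ → 0ℝ ≤ᴿ signed false x
0≤neg {x} x≤0 ε 0<ε = eventually-map (λ n p → begin
    0ℚ                                ≡⟨ ℚ.+-inverseʳ (seq x n) ⟨
    seq x n ℚ.- seq x n               ≤⟨ ℚ.+-monoˡ-≤ (ℚ.- seq x n) p ⟩
    (0ℚ ℚ.+ ε) ℚ.- seq x n            ≡⟨ regroup (seq x n) ε ⟩
    ℚ.- 1ℚ ℚ.* seq x n ℚ.+ ε          ∎) (x≤0 ε 0<ε)
  where
  open ℚ.≤-Reasoning
  regroup : ∀ p ε → (0ℚ ℚ.+ ε) ℚ.- p ≡ ℚ.- 1ℚ ℚ.* p ℚ.+ ε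
  regroup = solve 2 (λ p ε → (con 0ℚ :+ ε) :- p := con (ℚ.- 1ℚ) :* p :+ ε) refl

pos-neg⇒neg : ∀ {x} → x < 0ℝ → signed true x < 0ℝ
pos-neg⇒neg {x} = <-resp {x} {0ℝ} {signed true x} {0ℝ}
  (λ n → sym (ℚ.*-identityˡ (seq x n))) (λ n → refl)

pos-pos⇒pos : ∀ {x} → 0ℝ < x → 0ℝ < signed true x
pos-pos⇒pos {x} = <-resp {0ℝ} {x} {0ℝ} {signed true x}
  (λ n → refl) (λ n → sym (ℚ.*-identityˡ (seq x n)))

≤-reflexive : ∀ {x y} → (∀ n → seq x n ≡ seq y n) → x ≤ᴿ y
≤-reflexive {x} {y} eq = pointwise⇒≤ {x} {y} (λ n → ℚ.≤-reflexive (eq n))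

-- Points of the box and matrix-vector products

-- Rationals are stored in lowest terms, so both sides are compared as unnormalised fractions, where
-- an identity of integers remains.
/1-suc : ∀ k → + suc k ℚ./ 1 ≡ + k ℚ./ 1 ℚ.+ 1ℚ
/1-suc k = ℚ.toℚᵘ-injective (begin
  ℚ.toℚᵘ (+ suc k ℚ./ 1)                       ≈⟨ ℚ.toℚᵘ-fromℚᵘ (ℚᵘ.mkℚᵘ (+ suc k) 0) ⟩
  ℚᵘ.mkℚᵘ (+ suc k) 0                          ≈⟨ ℚᵘ.*≡* (cong (ℤ._* + 1) (begin-suc k)) ⟩
  ℚᵘ.mkℚᵘ (+ k) 0 ℚᵘ.+ ℚᵘ.1ℚᵘ                  ≈⟨ ℚᵘ.+-congˡ ℚᵘ.1ℚᵘ (ℚ.toℚᵘ-fromℚᵘ (ℚᵘ.mkℚᵘ (+ k) 0)) ⟨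
  ℚ.toℚᵘ (+ k ℚ./ 1) ℚᵘ.+ ℚ.toℚᵘ 1ℚ            ≈⟨ ℚ.toℚᵘ-homo-+ (+ k ℚ./ 1) 1ℚ ⟨
  ℚ.toℚᵘ (+ k ℚ./ 1 ℚ.+ 1ℚ)                    ∎)
  where
  open ℚᵘ.≃-Reasoning
  begin-suc : ∀ k → + suc k ≡ + k ℤ.* + 1 ℤ.+ + 1
  begin-suc k = trans (cong +_ (ℕ.+-comm 1 k)) (cong (ℤ._+ + 1) (sym (ℤ.*-identityʳ (+ k))))

/1-mono : ∀ {k l} → k ≤ l → + k ℚ./ 1 ℚ.≤ + l ℚ./ 1
/1-mono {k} {l} k≤l = ℚ.toℚᵘ-cancel-≤ (begin
  ℚ.toℚᵘ (+ k ℚ./ 1)    ≃⟨ ℚ.toℚᵘ-fromℚᵘ (ℚᵘ.mkℚᵘ (+ k) 0) ⟩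
  ℚᵘ.mkℚᵘ (+ k) 0       ≤⟨ ℚᵘ.*≤* (ℤ.*-monoʳ-≤-nonNeg (+ 1) (ℤ.+≤+ k≤l)) ⟩
  ℚᵘ.mkℚᵘ (+ l) 0       ≃⟨ ℚ.toℚᵘ-fromℚᵘ (ℚᵘ.mkℚᵘ (+ l) 0) ⟨
  ℚ.toℚᵘ (+ l ℚ./ 1)    ∎)
  where open ℚᵘ.≤-Reasoning

0≤/1 : ∀ k → 0ℚ ℚ.≤ + k ℚ./ 1
0≤/1 k = /1-mono {0} {k} z≤n

-- Both products vanish. The chain passes through `0ℝ * fromℚ p` and `0ℝ * fromℚ q` and uses one
-- half of `a ≈ 0ℝ` on each side.
*-zero-≤ : ∀ {a p q} → a ≈ 0ℝ → 0ℚ ℚ.≤ p → 0ℚ ℚ.≤ q → a * fromℚ p ≤ᴿ a * fromℚ q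
*-zero-≤ {a} {p} {q} a≈0 0≤p 0≤q =
  ≤-trans {a * fromℚ p} {0ℝ * fromℚ p} {a * fromℚ q}
    (*-monoʳ-≤ {a} {0ℝ} 0≤p (≈⇒≤ {a} {0ℝ} a≈0))
    (≤-trans {0ℝ * fromℚ p} {0ℝ * fromℚ q} {a * fromℚ q}
      (≤-reflexive {0ℝ * fromℚ p} {0ℝ * fromℚ q}
        λ n → trans (ℚ.*-zeroˡ p) (sym (ℚ.*-zeroˡ q)))
      (*-monoʳ-≤ {0ℝ} {a} 0≤q (≈⇒≥ {a} {0ℝ} a≈0)))

sum-mono-≤ : ∀ {n} (f g : Vector ℝ n) → (∀ j → f j ≤ᴿ g j) → sum f ≤ᴿ sum g
sum-mono-≤ {zero}  f g f≤g = ≤-refl {0ℝ}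
sum-mono-≤ {suc n} f g f≤g =
  +-mono-≤ {f zero} {g zero} {sum λ j → f (suc j)} {sum λ j → g (suc j)} (f≤g zero)
    (sum-mono-≤ (λ j → f (suc j)) (λ j → g (suc j)) (λ j → f≤g (suc j)))

-- A zero row takes the same value at all points; by symmetry in `x` and `y` one inequality
-- suffices.
·-zeros : ∀ {d m n} (A : Matrix m (Fin n)) (x y : Point d n) i →
  (∀ j → A i j ≈ 0ℝ) → (A · x) i ≤ᴿ (A · y) i
·-zeros A x y i zeros = sum-mono-≤ _ _ λ j →
  *-zero-≤ {A i j} {+ toℕ (lookup x j) ℚ./ 1} {+ toℕ (lookup y j) ℚ./ 1}
    (zeros j) (0≤/1 (toℕ (lookup x j))) (0≤/1 (toℕ (lookup y j)))

seq-sum : ∀ {n} (f : Vector ℝ n) N → seq (sum f) N ≡ ∑.sum (λ j → seq (f j) N)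
seq-sum {zero}  f N = refl
seq-sum {suc n} f N = cong (seq (f zero) N ℚ.+_) (seq-sum (λ j → f (suc j)) N)

opaque
  -- Opaque, so that a coordinate is an atom in later computations; `coord-def` gives access to its
  -- value.
  coord : ∀ {d} → Fin (suc d) → ℚ
  coord v = + toℕ v ℚ./ 1

  coord-def : ∀ {d} (v : Fin (suc d)) → + toℕ v ℚ./ 1 ≡ coord v
  coord-def v = refl

coord-mono : ∀ {d} {u v : Fin (suc d)} → toℕ u ≤ toℕ v → coord u ℚ.≤ coord v
coord-mono {u = u} {v} u≤v = subst₂ ℚ._≤_ (coord-def u) (coord-def v) (/1-mono {toℕ u} {toℕ v} u≤v)

coord-suc : ∀ {d d′} (u : Fin (suc d)) (v : Fin (suc d′)) → toℕ v ≡ suc (toℕ u) →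
  coord v ≡ coord u ℚ.+ 1ℚ
coord-suc u v eq = trans (sym (coord-def v)) (trans (cong (λ k → + k ℚ./ 1) eq)
  (trans (/1-suc (toℕ u)) (cong (ℚ._+ 1ℚ) (coord-def u))))

seq-· : ∀ {d m n} (A : Matrix m (Fin n)) (x : Point d n) i N →
  seq ((A · x) i) N ≡ ∑.sum (λ j → seq (A i j) N ℚ.* coord (lookup x j))
seq-· A x i N = trans
  (seq-sum (λ j → A i j * fromℕ (toℕ (lookup x j))) N)
  (∑.sum-cong-≗ λ j → cong (seq (A i j) N ℚ.*_) (coord-def (lookup x j)))

vec-ext : ∀ {A : Set} {n} {x y : Vec A n} → (∀ k → lookup x k ≡ lookup y k) → x ≡ y
vec-ext eq = Pointwise-≡⇒≡ (ext eq)

lookup-removeAt : ∀ {A : Set} {n} (x : Vec A (suc n)) j k →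
  lookup (removeAt x j) k ≡ lookup x (punchIn j k)
lookup-removeAt x j k = trans (sym (insertAt-punchIn (removeAt x j) j (lookup x j) k))
  (cong (λ y → lookup y (punchIn j k)) (insertAt-removeAt x j))

-- A change in coordinate `j` disappears, and any other single change survives at its shifted index.
-- This lets paths be projected.
differ-removeAt : ∀ {d n} {x y : Point d (suc n)} j → DifferInOne x y →
  removeAt x j ≡ removeAt y j ⊎ DifferInOne (removeAt x j) (removeAt y j)
differ-removeAt {x = x} {y} j (k , x≢y , same) = go (k ≟ j)
  where
  go : Dec (k ≡ j) → removeAt x j ≡ removeAt y j ⊎ DifferInOne (removeAt x j) (removeAt y j)
  go (yes refl) = inj₁ (vec-ext λ l → trans (lookup-removeAt x j l)
    (trans (same (punchIn j l) (Fin.punchInᵢ≢i j l)) (sym (lookup-removeAt y j l))))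
  go (no k≢j) = inj₂ (k′ ,
    (λ eq → x≢y (trans (sym (atk x)) (trans eq (atk y)))) ,
    (λ l l≢k′ → trans (lookup-removeAt x j l)
      (trans (same (punchIn j l) (λ eq → l≢k′ (Fin.punchIn-injective j l k′
               (trans eq (sym (Fin.punchIn-punchOut j≢k))))))
             (sym (lookup-removeAt y j l)))))
    where
    j≢k : j ≢ k
    j≢k eq = k≢j (sym eq)
    k′ = punchOut j≢k
    atk : ∀ z → lookup (removeAt z j) k′ ≡ lookup z k
    atk z = trans (lookup-removeAt z j k′) (cong (lookup z) (Fin.punchIn-punchOut j≢k))

remove-column : ∀ {m n} → Matrix m (Fin (suc n)) → Fin (suc n) → Matrix m (Fin n)
remove-column A j i k = A i (punchIn j k)

·-removeAt : ∀ {d m n} (A : Matrix m (Fin (suc n))) (z : Point d (suc n)) j i N →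
  seq ((A · z) i) N ≡
  seq (A i j) N ℚ.* coord (lookup z j) ℚ.+ seq ((remove-column A j · removeAt z j) i) N
·-removeAt A z j i N = begin
  seq ((A · z) i) N                                     ≡⟨ seq-· A z i N ⟩
  ∑.sum term                                            ≡⟨ ∑.sum-remove {i = j} term ⟩
  term j ℚ.+ ∑.sum (λ k → term (punchIn j k))
    ≡⟨ cong (term j ℚ.+_) (∑.sum-cong-≗ λ k →
         cong (λ u → seq (A i (punchIn j k)) N ℚ.* coord u) (sym (lookup-removeAt z j k))) ⟩
  term j ℚ.+ ∑.sum (λ k → seq (A i (punchIn j k)) N ℚ.* coord (lookup (removeAt z j) k))
    ≡⟨ cong (term j ℚ.+_) (sym (seq-· (remove-column A j) (removeAt z j) i N)) ⟩
  term j ℚ.+ seq ((remove-column A j · removeAt z j) i) N  ∎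
  where
  open ≡-Reasoning
  term : Vector ℚ _
  term k = seq (A i k) N ℚ.* coord (lookup z k)

-- Once column `l` is split off, both points leave the same remainder, so only the terms of column
-- `l` differ.
·-change : ∀ {d m n} (A : Matrix m (Fin n)) (x y : Point d n) l →
  (∀ k → k ≢ l → lookup x k ≡ lookup y k) → ∀ i N →
  seq ((A · y) i) N ≡
  seq ((A · x) i) N ℚ.+ seq (A i l) N ℚ.* (coord (lookup y l) ℚ.- coord (lookup x l))
·-change {d} {n = suc n} A x y l same i N = begin
  seq ((A · y) i) N                       ≡⟨ ·-removeAt A y l i N ⟩
  a ℚ.* v ℚ.+ rest (removeAt y l)
    ≡⟨ cong (a ℚ.* v ℚ.+_) (cong rest {removeAt y l} {removeAt x l} (sym removed)) ⟩
  a ℚ.* v ℚ.+ rest (removeAt x l)         ≡⟨ regroup a u v (rest (removeAt x l)) ⟩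
  (a ℚ.* u ℚ.+ rest (removeAt x l)) ℚ.+ a ℚ.* (v ℚ.- u)
    ≡⟨ cong (ℚ._+ a ℚ.* (v ℚ.- u)) (sym (·-removeAt A x l i N)) ⟩
  seq ((A · x) i) N ℚ.+ a ℚ.* (v ℚ.- u)   ∎
  where
  open ≡-Reasoning
  a = seq (A i l) N
  u = coord (lookup x l)
  v = coord (lookup y l)
  rest : Point d n → ℚ
  rest z = seq ((remove-column A l · z) i) N
  removed : removeAt x l ≡ removeAt y l
  removed = vec-ext λ k → trans (lookup-removeAt x l k)
    (trans (same (punchIn l k) (Fin.punchInᵢ≢i l k)) (sym (lookup-removeAt y l k)))
  regroup : ∀ a u v r → a ℚ.* v ℚ.+ r ≡ (a ℚ.* u ℚ.+ r) ℚ.+ a ℚ.* (v ℚ.- u)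
  regroup = solve 4 (λ a u v r → a :* v :+ r := (a :* u :+ r) :+ a :* (v :- u)) refl

-- Removing an eliminable column

AlwaysConnected : ∀ d {m n} → Matrix m (Fin n) → Set
AlwaysConnected d {m} A = ∀ (b : Vector ℝ m) → Connected (Solutions d A b)

+-cancelˡ-≤ : ∀ {x y z} → x + y ≤ᴿ x + z → y ≤ᴿ z
+-cancelˡ-≤ {x} {y} {z} le δ 0<δ = eventually-map (λ N p →
  subst₂ ℚ._≤_ (cancelˡ (seq x N) (seq y N)) (regroup (seq x N) (seq z N) δ)
    (ℚ.+-monoˡ-≤ (ℚ.- seq x N) p)) (le δ 0<δ)
  where
  regroup : ∀ x z δ → (x ℚ.+ z ℚ.+ δ) ℚ.- x ≡ z ℚ.+ δ
  regroup = solve 3 (λ x z δ → (x :+ z :+ δ) :- x := z :+ δ) refl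

·-removeAtᴿ : ∀ {d m n} (A : Matrix m (Fin (suc n))) (z : Point d (suc n)) j i N →
  seq ((A · z) i) N ≡
  seq (A i j * fromℚ (coord (lookup z j)) + (remove-column A j · removeAt z j) i) N
·-removeAtᴿ A z j i N = ·-removeAt A z j i N

lift-row : ∀ {b c r s} → (∀ N → seq s N ≡ seq (c + r) N) → b ≤ᴿ r → c + b ≤ᴿ s
lift-row {b} {c} {r} {s} s≡ b≤r = ≤-trans {c + b} {c + r} {s}
  (+-mono-≤ {c} {c} {b} {r} (≤-refl {c}) b≤r) (≤-reflexive {c + r} {s} λ N → sym (s≡ N))

-- Here `c` is the best contribution of the removed column and `c′` the actual one. Raising `c′` to
-- `c` preserves the bound, and then `c` cancels.
lower-row : ∀ {b c c′ r s} → (∀ N → seq s N ≡ seq (c′ + r) N) → c′ ≤ᴿ c → c + b ≤ᴿ s → b ≤ᴿ r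
lower-row {b} {c} {c′} {r} {s} s≡ c′≤c c+b≤s = +-cancelˡ-≤ {c} {b} {r}
  (≤-trans {c + b} {s} {c + r} c+b≤s
    (≤-trans {s} {c′ + r} {c + r} (≤-reflexive {s} {c′ + r} s≡)
      (+-mono-≤ {c′} {c} {r} {r} c′≤c (≤-refl {r}))))

insertAt-· : ∀ {d m n} (A : Matrix m (Fin (suc n))) (z : Point d n) j v i N →
  seq ((A · insertAt z j v) i) N ≡ seq (A i j * fromℚ (coord v) + (remove-column A j · z) i) N
insertAt-· {d} {m} {n} A z j v i N = trans (·-removeAtᴿ A (insertAt z j v) j i N)
  (same (lookup (insertAt z j v) j) v (removeAt (insertAt z j v) j) z
    (insertAt-lookup z j v) (removeAt-insertAt z j v))
  where
  same : ∀ (u w : Fin (suc d)) (x y : Point d n) → u ≡ w → x ≡ y →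
    seq (A i j * fromℚ (coord u) + (remove-column A j · x) i) N ≡
    seq (A i j * fromℚ (coord w) + (remove-column A j · y) i) N
  same u .u x .x refl refl = refl

-- Setting the removed variable to v is always the best choice, so a path
-- for A projects to a path for the remaining columns.
module _ {d m n} (A : Matrix m (Fin (suc n))) (j : Fin (suc n)) (v : Fin (suc d))
  (best : ∀ i → (∀ k → A i (punchIn j k) ≈ 0ℝ) ⊎
                (∀ (u : Fin (suc d)) → A i j * fromℚ (coord u) ≤ᴿ A i j * fromℚ (coord v)))
  (b : Vector ℝ m) (x : Point d n) (x∈R : x ∈ Solutions d (remove-column A j) b)
  where
  private
    R  = Solutions d (remove-column A j) b
    R′ = Solutions d A (λ i → A i j * fromℚ (coord v) + b i)

    lift : ∀ z → z ∈ R → insertAt z j v ∈ R′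
    lift z z∈R i = lift-row
      {b i} {A i j * fromℚ (coord v)} {(remove-column A j · z) i} {(A · insertAt z j v) i}
      (insertAt-· A z j v i) (z∈R i)

    lower : ∀ z → z ∈ R′ → removeAt z j ∈ R
    lower z z∈ i = go (best i)
      where
      go : (∀ k → A i (punchIn j k) ≈ 0ℝ) ⊎
           (∀ (u : Fin (suc d)) → A i j * fromℚ (coord u) ≤ᴿ A i j * fromℚ (coord v)) →
           b i ≤ᴿ (remove-column A j · removeAt z j) i
      -- The row vanishes on the remaining columns, so its value does not depend on the point and
      -- the bound is inherited from `x`.
      go (inj₁ zeros) = ≤-trans
        {b i} {(remove-column A j · x) i} {(remove-column A j · removeAt z j) i}
        (x∈R i) (·-zeros (remove-column A j) x (removeAt z j) i zeros)
      go (inj₂ ≤av) = lower-row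
        {b i} {A i j * fromℚ (coord v)} {A i j * fromℚ (coord (lookup z j))}
        {(remove-column A j · removeAt z j) i} {(A · z) i}
        (·-removeAtᴿ A z j i) (≤av (lookup z j)) (z∈ i)

    project : ∀ {z w} → Adjacent R′ z w → Star (Adjacent R) (removeAt z j) (removeAt w j)
    project {z} {w} (z∈ , w∈ , differ) = go (differ-removeAt {x = z} {w} j differ)
      where
      go : removeAt z j ≡ removeAt w j ⊎ DifferInOne (removeAt z j) (removeAt w j) →
           Star (Adjacent R) (removeAt z j) (removeAt w j)
      -- A step in the removed coordinate projects to the empty path.
      go (inj₁ eq)      =
        subst (Star (Adjacent R) (removeAt z j)) {removeAt z j} {removeAt w j} eq nil
      go (inj₂ differ′) = _◅_ {j = removeAt w j} (lower z z∈ , lower w w∈ , differ′) nil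

  connected-remove : AlwaysConnected d A → ∀ y → y ∈ Solutions d (remove-column A j) b →
    Star (Adjacent (Solutions d (remove-column A j) b)) x y
  connected-remove conn y y∈R =
    subst₂ (Star (Adjacent R))
      {removeAt (insertAt x j v) j} {x} {removeAt (insertAt y j v) j} {y}
      (removeAt-insertAt x j v) (removeAt-insertAt y j v) projected
    where
    path : Star (Adjacent R′) (insertAt x j v) (insertAt y j v)
    path = conn (λ i → A i j * fromℚ (coord v) + b i)
      (insertAt x j v) (insertAt y j v) (lift x x∈R) (lift y y∈R)
    projected : Star (Adjacent R) (removeAt (insertAt x j v) j) (removeAt (insertAt y j v) j)
    projected = kleisliStar {T = Adjacent R′} {U = Adjacent R} (λ z → removeAt z j)
      (λ {z} {w} → project {z} {w}) path

p≤q⇒0≤q-p : ∀ {p q} → p ℚ.≤ q → 0ℚ ℚ.≤ q ℚ.- p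
p≤q⇒0≤q-p {p} {q} p≤q = subst (ℚ._≤ q ℚ.- p) (ℚ.+-inverseʳ p) (ℚ.+-monoˡ-≤ (ℚ.- p) p≤q)

-- Multiply `0 ≤ a` by the nonnegative rational `q - p` and add `a * p` to both sides.
*-monoˡ-≤-nonNeg : ∀ {a p q} → 0ℝ ≤ᴿ a → p ℚ.≤ q → a * fromℚ p ≤ᴿ a * fromℚ q
*-monoˡ-≤-nonNeg {a} {p} {q} 0≤a p≤q ε 0<ε = eventually-map
  (λ N le → subst₂ ℚ._≤_ (left (seq a N) p q) (right (seq a N) p q ε) (ℚ.+-monoˡ-≤ (seq a N ℚ.* p) le))
  (*-monoʳ-≤ {0ℝ} {a} {q ℚ.- p} (p≤q⇒0≤q-p p≤q) 0≤a ε 0<ε)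
  where
  left : ∀ a p q → 0ℚ ℚ.* (q ℚ.- p) ℚ.+ a ℚ.* p ≡ a ℚ.* p
  left = solve 3 (λ a p q → con 0ℚ :* (q :- p) :+ a :* p := a :* p) refl
  right : ∀ a p q ε → (a ℚ.* (q ℚ.- p) ℚ.+ ε) ℚ.+ a ℚ.* p ≡ a ℚ.* q ℚ.+ ε
  right = solve 4 (λ a p q ε → (a :* (q :- p) :+ ε) :+ a :* p := a :* q :+ ε) refl

*-monoˡ-≤-nonPos : ∀ {a p q} → a ≤ᴿ 0ℝ → p ℚ.≤ q → a * fromℚ q ≤ᴿ a * fromℚ p
*-monoˡ-≤-nonPos {a} {p} {q} a≤0 p≤q ε 0<ε = eventually-map
  (λ N le → subst₂ ℚ._≤_ (left (seq a N) p q) (right (seq a N) p q ε) (ℚ.+-monoˡ-≤ (seq a N ℚ.* p) le))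
  (*-monoʳ-≤ {a} {0ℝ} {q ℚ.- p} (p≤q⇒0≤q-p p≤q) a≤0 ε 0<ε)
  where
  left : ∀ a p q → a ℚ.* (q ℚ.- p) ℚ.+ a ℚ.* p ≡ a ℚ.* q
  left = solve 3 (λ a p q → a :* (q :- p) :+ a :* p := a :* q) refl
  right : ∀ a p q ε → (0ℚ ℚ.* (q ℚ.- p) ℚ.+ ε) ℚ.+ a ℚ.* p ≡ a ℚ.* p ℚ.+ ε
  right = solve 4 (λ a p q ε → (con 0ℚ :* (q :- p) :+ ε) :+ a :* p := a :* p :+ ε) refl

-- In case (i) each row either vanishes outside column `j` or has a nonpositive entry there, so the
-- smallest value of the removed variable is best; in case (ii) it is the largest.
remove-column-connected : ExcludedMiddle 0ℓ → ∀ {d m n} (A : Matrix m (Fin (suc n))) j →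
  CanBeEliminatedAt A j → AlwaysConnected d A → AlwaysConnected d (remove-column A j)
remove-column-connected em {d} A j (inj₁ h) conn b x y x∈ y∈ =
  connected-remove A j zero (λ i → best i em) b x x∈ conn y y∈
  where
  best : ∀ i → Dec (0ℝ < A i j) → (∀ k → A i (punchIn j k) ≈ 0ℝ) ⊎
    (∀ (u : Fin (suc d)) → A i j * fromℚ (coord u) ≤ᴿ A i j * fromℚ (coord {d} zero))
  best i (yes pos) = inj₁ λ k → h i pos (punchIn j k) (Fin.punchInᵢ≢i j k)
  best i (no ¬pos) = inj₂ λ u → *-monoˡ-≤-nonPos {A i j} {coord {d} zero} {coord u}
    (≮⇒≥ {0ℝ} {A i j} ¬pos) (coord-mono {u = zero} {u} z≤n)
remove-column-connected em {d} A j (inj₂ h) conn b x y x∈ y∈ =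
  connected-remove A j (Fin.fromℕ d) (λ i → best i em) b x x∈ conn y y∈
  where
  best : ∀ i → Dec (A i j < 0ℝ) → (∀ k → A i (punchIn j k) ≈ 0ℝ) ⊎
    (∀ (u : Fin (suc d)) → A i j * fromℚ (coord u) ≤ᴿ A i j * fromℚ (coord (Fin.fromℕ d)))
  best i (yes neg) = inj₁ λ k → h i neg (punchIn j k) (Fin.punchInᵢ≢i j k)
  best i (no ¬neg) = inj₂ λ u → *-monoˡ-≤-nonNeg {A i j} {coord u} {coord (Fin.fromℕ d)}
    (≮⇒≥ {A i j} {0ℝ} ¬neg) (coord-mono {u = u} {Fin.fromℕ d} (Fin.≤fromℕ u))

-- The matrices have different column types. It suffices that every other column of `B′` copies some
-- column of `B` besides `c`, since elimination only asks for zeros in those columns.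
eliminated-transfer : ∀ {m J J′} {B : Matrix m J} {B′ : Matrix m J′} {c c′} →
  (∀ i → B′ i c′ ≡ B i c) → (∀ j′ → j′ ≢ c′ → ∃[ k ] k ≢ c × (∀ i → B′ i j′ ≡ B i k)) →
  CanBeEliminatedAt B c → CanBeEliminatedAt B′ c′
eliminated-transfer {B = B} {B′} {c} {c′} col other = λ where
    (inj₁ h) → inj₁ λ i pos j′ j′≢c′ →
      zeros (other j′ j′≢c′) i (h i (subst (0ℝ <_) (col i) pos))
    (inj₂ h) → inj₂ λ i neg j′ j′≢c′ →
      zeros (other j′ j′≢c′) i (h i (subst (_< 0ℝ) (col i) neg))
  where
  zeros : ∀ {j′} → ∃[ k ] k ≢ c × (∀ i → B′ i j′ ≡ B i k) → ∀ i →
    (∀ k → k ≢ c → B i k ≈ 0ℝ) → B′ i j′ ≈ 0ℝ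
  zeros (k , k≢c , eq) i h = subst (_≈ 0ℝ) (sym (eq i)) (h k k≢c)

-- Column `j` comes first and the given ordering follows, shifted past `j`. The columns left at
-- position `suc t` are the `punchIn j` images of those left in the smaller matrix at position `t`.
insert-ordering : ∀ {m n} (A : Matrix m (Fin (suc n))) j → CanBeEliminatedAt A j →
  HasEliminationOrdering (remove-column A j) → HasEliminationOrdering A
insert-ordering {m} {n} A j elim (σ′ , ordering) = σ , λ where
    zero    → eliminated-transfer {B = A} {elm A (Before σ zero)} {j} {current σ zero}
                (λ i → refl)
                (λ j′ j′≢ → value j′ , (λ eq → j′≢ (remaining-≡ {p = zero} eq)) , λ i → refl)
                elim
    (suc t) → eliminated-transfer {B = elm (remove-column A j) (Before σ′ t)}
                {elm A (Before σ (suc t))} {current σ′ t} {current σ (suc t)}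
                (λ i → cong (A i) (σ-suc t)) (other t) (ordering t)
  where
  σ : Perm.Permutation′ (suc n)
  σ = Perm.insert zero j σ′
  σ-suc : ∀ t → σ ⟨$⟩ʳ suc t ≡ punchIn j (σ′ ⟨$⟩ʳ t)
  σ-suc = Perm.insert-punchIn zero j σ′
  remaining-≡ : ∀ {p} {k l : Remaining (Before σ p)} → value k ≡ value l → k ≡ l
  remaining-≡ refl = refl
  other : ∀ t (j′ : Remaining (Before σ (suc t))) → j′ ≢ current σ (suc t) →
    ∃[ k ] k ≢ current σ′ t × (∀ i → A i (value j′) ≡ A i (punchIn j (value k)))
  other t j′@(l , [ l∉ ]) j′≢ =
    (k , [ (λ (s , s<t , σ′s≡k) → l∉ (suc s , s≤s s<t ,
            trans (σ-suc s) (trans (cong (punchIn j) σ′s≡k) punchIn-k))) ]) ,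
    (λ eq → j′≢ (remaining-≡ {p = suc t}
      (trans (sym punchIn-k) (trans (cong (λ k → punchIn j (value k)) eq) (sym (σ-suc t)))))) ,
    (λ i → cong (A i) (sym punchIn-k))
    where
    j≢l : j ≢ l
    -- Position `zero` holds `j`, so `l ≡ j` would place `l` before `suc t`.
    j≢l j≡l = Irrelevant.⊥-elim (l∉ (zero , s≤s z≤n , j≡l))
    k = punchOut j≢l
    punchIn-k : punchIn j k ≡ l
    punchIn-k = Fin.punchIn-punchOut j≢l

-- Isolated corners

-- `true` picks the lower end of the range and `false` the upper one. The range goes from 0 to
-- `suc d`, so a step inwards always exists.
corner step : ∀ {d} → Bool → Fin (suc (suc d))
corner true      = zero
corner {d} false = Fin.fromℕ (suc d)
step true      = suc zero
step {d} false = inject₁ (Fin.fromℕ d)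

coord-step : ∀ {d} s → coord (step {d} s) ≡ coord (corner {d} s) ℚ.+ sign s
coord-step {d} true = coord-suc (corner {d} true) (step {d} true) refl
coord-step {d} false = trans (sym (cancelʳ (coord (step {d} false)) 1ℚ))
  (cong (ℚ._- 1ℚ) (sym (coord-suc (step {d} false) (corner {d} false)
    (cong suc (sym (Fin.toℕ-inject₁ (Fin.fromℕ d)))))))

step≢corner : ∀ {d} s → step {d} s ≢ corner s
step≢corner true  ()
step≢corner {d} false eq =
  ℕ.1+n≢n (sym (trans (sym (Fin.toℕ-inject₁ (Fin.fromℕ d))) (cong toℕ eq)))

*-sign-involutive : ∀ s p → sign s ℚ.* (sign s ℚ.* p) ≡ p
*-sign-involutive true  = solve 1 (λ p → con 1ℚ :* (con 1ℚ :* p) := p) refl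
*-sign-involutive false = solve 1 (λ p → con (ℚ.- 1ℚ) :* (con (ℚ.- 1ℚ) :* p) := p) refl

-- Coordinates are integers and the corner is an end of their range, so any other value lies at
-- least one unit inwards; `sign s` makes inwards positive.
1≤distance : ∀ {d} s (v : Fin (suc (suc d))) → v ≢ corner s →
  1ℚ ℚ.≤ sign s ℚ.* (coord v ℚ.- coord (corner {d} s))
1≤distance {d} true v v≢0 = subst₂ ℚ._≤_
  (trans (cong (ℚ._- o) (coord-step {d} true)) (cancelˡ o 1ℚ))
  (sym (ℚ.*-identityˡ (coord v ℚ.- o)))
  (ℚ.+-monoˡ-≤ (ℚ.- o) (coord-mono {u = step {d} true} {v} (positive v v≢0)))
  where
  o = coord (corner {d} true)
  positive : ∀ (v : Fin (suc (suc d))) → v ≢ zero → 1 ≤ toℕ v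
  positive zero    v≢0 = ⊥-elim (v≢0 refl)
  positive (suc v) v≢0 = s≤s z≤n
1≤distance {d} false v v≢d = subst₂ ℚ._≤_
  (trans (cong (λ u → o ℚ.- u) (coord-step {d} false)) (left o))
  (right o (coord v))
  (ℚ.+-monoʳ-≤ o (ℚ.neg-antimono-≤ (coord-mono {u = v} {step {d} false} v≤)))
  where
  o = coord (corner {d} false)
  left : ∀ o → o ℚ.- (o ℚ.- 1ℚ) ≡ 1ℚ
  left = solve 1 (λ o → o :- (o :- con 1ℚ) := con 1ℚ) refl
  right : ∀ o v → o ℚ.- v ≡ ℚ.- 1ℚ ℚ.* (v ℚ.- o)
  right = solve 2 (λ o v → o :- v := con (ℚ.- 1ℚ) :* (v :- o)) refl
  v≤ : toℕ v ≤ toℕ (step {d} false)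
  v≤ = subst (toℕ v ≤_) (sym (trans (Fin.toℕ-inject₁ (Fin.fromℕ d)) (Fin.toℕ-fromℕ d)))
    (ℕ.≤-pred (ℕ.≤∧≢⇒< (ℕ.≤-pred (Fin.toℕ<n v))
      (λ eq → v≢d (Fin.toℕ-injective (trans eq (sym (Fin.toℕ-fromℕ (suc d))))))))

-- Here `a` is an inward oriented entry. Being negative, it makes a move by `t` of at least 1 lose
-- no less than a unit step, which already ends below `c + δ`.
<-jump : ∀ {a c δ x y} t → 1ℚ ℚ.≤ t →
  (∀ N → seq x N ≡ seq c N ℚ.+ seq a N ℚ.* t) → (∀ N → seq y N ≡ seq c N ℚ.+ seq δ N) →
  a < 0ℝ → a < δ → x < y
<-jump {a} {c} {δ} {x} {y} t 1≤t x≡ y≡ (η , 0<η , a<0) (ε , 0<ε , a<δ) = ε , 0<ε ,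
  eventually-map (λ N (p , q) → begin
      seq x N ℚ.+ ε                       ≡⟨ cong (ℚ._+ ε) (x≡ N) ⟩
      seq c N ℚ.+ seq a N ℚ.* t ℚ.+ ε
        ≤⟨ ℚ.+-monoˡ-≤ ε (ℚ.+-monoʳ-≤ (seq c N) (stretch (seq a N) (ℚ.≤-trans (p≤p+ε (seq a N) 0<η) p))) ⟩
      seq c N ℚ.+ seq a N ℚ.+ ε           ≡⟨ ℚ.+-assoc (seq c N) (seq a N) ε ⟩
      seq c N ℚ.+ (seq a N ℚ.+ ε)         ≤⟨ ℚ.+-monoʳ-≤ (seq c N) q ⟩
      seq c N ℚ.+ seq δ N                 ≡⟨ sym (y≡ N) ⟩
      seq y N                             ∎)
    (both a<0 a<δ)
  where
  open ℚ.≤-Reasoning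
  stretch : ∀ a → a ℚ.≤ 0ℚ → a ℚ.* t ℚ.≤ a
  stretch a a≤0 = subst (a ℚ.* t ℚ.≤_) (ℚ.*-identityʳ a)
    (ℚ.*-monoˡ-≤-nonPos a {{ℚ.nonPositive a≤0}} 1≤t)

-- Deciding `x < y` selects the minimum. The last component lets a value below both entries violate
-- the bound.
lower-bound : ExcludedMiddle 0ℓ → ∀ x y →
  ∃[ z ] z ≤ᴿ x × z ≤ᴿ y × (∀ w → w < x → w < y → w < z)
lower-bound em x y = go em
  where
  go : Dec (x < y) → ∃[ z ] z ≤ᴿ x × z ≤ᴿ y × (∀ w → w < x → w < y → w < z)
  go (yes x<y) = x , ≤-refl {x} , <⇒≤ {x} {y} x<y , λ w w<x w<y → w<x
  go (no x≮y)  = y , ≮⇒≥ {x} {y} x≮y , ≤-refl {y} , λ w w<x w<y → w<y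

-- The corner c of the box selected by σ is an isolated vertex when b is the
-- minimum of A c and A y, where y arises from c by one step inwards along
-- each column in S.
module Isolation {d m n : ℕ} (A : Matrix m (Fin n)) (σ : Fin n → Bool) where

  toward : Matrix m (Fin n)
  toward i j = signed (σ j) (A i j)

  -- For `S` without repetitions, the change of row `i` from `corners` to `displaced S`.
  total : List (Fin n) → Fin m → ℝ
  total S i = List.foldr (λ j r → toward i j + r) 0ℝ S

  corners : Point (suc d) n
  corners = tabulate λ j → corner (σ j)

  displaced : List (Fin n) → Point (suc d) n
  displaced = List.foldr (λ j z → z [ j ]≔ step (σ j)) corners

  lookup-displaced : ∀ {S j} → All (j ≢_) S → lookup (displaced S) j ≡ corner (σ j)
  lookup-displaced {j = j} All.[] = lookup∘tabulate (λ j → corner (σ j)) j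
  lookup-displaced {k List.∷ S} (j≢k All.∷ j∉S) =
    trans (lookup∘update′ j≢k (displaced S) (step (σ k))) (lookup-displaced j∉S)

  seq-total-∷ : ∀ j S i N →
    seq (total (j List.∷ S) i) N ≡ sign (σ j) ℚ.* seq (A i j) N ℚ.+ seq (total S i) N
  seq-total-∷ j S i N = refl

  -- Columns move one at a time. Since `S` has no repetitions, column `j` is still at its corner
  -- when it moves, so its coordinate changes by exactly `sign (σ j)`.
  seq-displaced : ∀ {S} → Unique S → ∀ i N →
    seq ((A · displaced S) i) N ≡ seq ((A · corners) i) N ℚ.+ seq (total S i) N
  seq-displaced AllPairs.[] i N = trans (same {displaced List.[]} {corners} refl)
    (trans (sym (ℚ.+-identityʳ (seq ((A · corners) i) N)))
      (cong (seq ((A · corners) i) N ℚ.+_) {0ℚ} {seq (total List.[] i) N} refl))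
    where
    same : ∀ {x y} → x ≡ y → seq ((A · x) i) N ≡ seq ((A · y) i) N
    same refl = refl
  seq-displaced {j List.∷ S} (j∉S AllPairs.∷ S!) i N =
    step-in (seq ((A · displaced (j List.∷ S)) i) N) (seq ((A · displaced S) i) N)
      (seq ((A · corners) i) N) (seq (total S i) N) (seq (total (j List.∷ S) i) N)
      (seq (A i j) N) (coord (lookup (displaced (j List.∷ S)) j) ℚ.- coord (lookup (displaced S) j))
      (·-change A (displaced S) (displaced (j List.∷ S)) j
        (λ k k≢j → sym (lookup∘update′ k≢j (displaced S) (step (σ j)))) i N)
      difference (seq-displaced {S} S! i N) (seq-total-∷ j S i N)
    where
    difference : coord (lookup (displaced (j List.∷ S)) j) ℚ.- coord (lookup (displaced S) j)
      ≡ sign (σ j)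
    difference = trans
      (cong₂ (λ u v → coord u ℚ.- coord v)
        {lookup (displaced (j List.∷ S)) j} {step (σ j)} {lookup (displaced S) j} {corner (σ j)}
        (lookup∘update j (displaced S) (step (σ j))) (lookup-displaced j∉S))
      (trans (cong (ℚ._- coord (corner {d} (σ j))) (coord-step {d} (σ j)))
             (cancelˡ (coord (corner {d} (σ j))) (sign (σ j))))
    step-in : ∀ y z c t t′ a δ → y ≡ z ℚ.+ a ℚ.* δ → δ ≡ sign (σ j) → z ≡ c ℚ.+ t →
      t′ ≡ sign (σ j) ℚ.* a ℚ.+ t → y ≡ c ℚ.+ t′
    step-in _ _ c t _ a _ refl refl refl refl = regroup c t a (sign (σ j))
      where
      regroup : ∀ p q a s → p ℚ.+ q ℚ.+ a ℚ.* s ≡ p ℚ.+ (s ℚ.* a ℚ.+ q)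
      regroup = solve 4 (λ p q a s → p :+ q :+ a :* s := p :+ (s :* a :+ q)) refl

  -- Multiplying twice by `sign (σ l)` changes nothing: one factor orients the entry, the other
  -- turns the coordinate change into an inward distance.
  neighbour-seq : ∀ (z : Point (suc d) n) l → (∀ k → k ≢ l → lookup corners k ≡ lookup z k) →
    ∀ i N → seq ((A · z) i) N ≡ seq ((A · corners) i) N ℚ.+
      seq (toward i l) N ℚ.* (sign (σ l) ℚ.* (coord (lookup z l) ℚ.- coord (corner {d} (σ l))))
  neighbour-seq z l same i N = begin
    seq ((A · z) i) N                     ≡⟨ ·-change A corners z l same i N ⟩
    c ℚ.+ a ℚ.* (coord v ℚ.- coord (lookup corners l))
      ≡⟨ cong (λ u → c ℚ.+ a ℚ.* (coord v ℚ.- coord u)) {lookup corners l} {corner (σ l)}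
           (lookup∘tabulate (λ j → corner (σ j)) l) ⟩
    c ℚ.+ a ℚ.* δ                         ≡⟨ cong (λ u → c ℚ.+ a ℚ.* u) (sym (*-sign-involutive (σ l) δ)) ⟩
    c ℚ.+ a ℚ.* (s ℚ.* (s ℚ.* δ))         ≡⟨ regroup c a s (s ℚ.* δ) ⟩
    c ℚ.+ s ℚ.* a ℚ.* (s ℚ.* δ)           ∎
    where
    open ≡-Reasoning
    a = seq (A i l) N
    c = seq ((A · corners) i) N
    v = lookup z l
    s = sign (σ l)
    δ = coord v ℚ.- coord (corner {d} (σ l))
    regroup : ∀ c a s e → c ℚ.+ a ℚ.* (s ℚ.* e) ≡ c ℚ.+ s ℚ.* a ℚ.* e
    regroup = solve 4 (λ c a s e → c :+ a :* (s :* e) := c :+ s :* a :* e) refl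

  -- A neighbour of the corner changes a single column `l`, and row `f l` then falls below its
  -- values at the corner and at the displaced point, hence below `b`. So a path from the corner has
  -- no first edge.
  isolated : ExcludedMiddle 0ℓ → AlwaysConnected (suc d) A →
    ∀ {j S} → Unique (j List.∷ S) → (f : Fin n → Fin m) →
    (∀ l → toward (f l) l < 0ℝ) → (∀ l → toward (f l) l < total (j List.∷ S) (f l)) → ⊥
  isolated em connected {j} {S} S! f neg below =
    go (connected b corners (displaced (j List.∷ S)) c∈ y∈) refl
    where
    bound : ∀ i → ∃[ z ] z ≤ᴿ (A · corners) i × z ≤ᴿ (A · displaced (j List.∷ S)) i ×
      (∀ w → w < (A · corners) i → w < (A · displaced (j List.∷ S)) i → w < z)
    bound i = lower-bound em ((A · corners) i) ((A · displaced (j List.∷ S)) i)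
    b : Vector ℝ m
    b i = bound i .proj₁
    b-greatest : ∀ i w → w < (A · corners) i → w < (A · displaced (j List.∷ S)) i → w < b i
    b-greatest i = bound i .proj₂ .proj₂ .proj₂
    c∈ : corners ∈ Solutions (suc d) A b
    c∈ i = bound i .proj₂ .proj₁
    y∈ : displaced (j List.∷ S) ∈ Solutions (suc d) A b
    y∈ i = bound i .proj₂ .proj₂ .proj₁
    -- The list is nonempty, and column `j` has left its corner.
    c≢y : corners ≢ displaced (j List.∷ S)
    c≢y eq = step≢corner (σ j) (trans (sym (lookup∘update j (displaced S) (step (σ j))))
      (trans (cong (λ z → lookup z j) (sym eq)) (lookup∘tabulate (λ j → corner (σ j)) j)))
    neighbour∉ : ∀ z → DifferInOne corners z → z ∉ Solutions (suc d) A b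
    neighbour∉ z (l , differ , same) z∈ = <⇒≱ {(A · z) (f l)} {b (f l)}
      (b-greatest (f l) ((A · z) (f l))
        -- With `δ = 0ℝ` the neighbour is compared with the corner itself; the second jump compares
        -- it with the displaced point.
        (<-jump {toward (f l) l} {(A · corners) (f l)} {0ℝ} {(A · z) (f l)} {(A · corners) (f l)}
          (sign (σ l) ℚ.* (coord (lookup z l) ℚ.- coord (corner {d} (σ l)))) 1≤t
          (neighbour-seq z l same (f l))
          (λ N → sym (ℚ.+-identityʳ (seq ((A · corners) (f l)) N)))
          (neg l) (neg l))
        (<-jump {toward (f l) l} {(A · corners) (f l)} {total (j List.∷ S) (f l)}
          {(A · z) (f l)} {(A · displaced (j List.∷ S)) (f l)}
          (sign (σ l) ℚ.* (coord (lookup z l) ℚ.- coord (corner {d} (σ l)))) 1≤t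
          (neighbour-seq z l same (f l)) (seq-displaced S! (f l))
          (neg l) (below l)))
      (z∈ (f l))
      where
      1≤t : 1ℚ ℚ.≤ sign (σ l) ℚ.* (coord (lookup z l) ℚ.- coord (corner {d} (σ l)))
      1≤t = 1≤distance {d} (σ l) (lookup z l)
        (λ eq → differ (trans (lookup∘tabulate (λ j → corner (σ j)) l) (sym eq)))
    go : ∀ {z} → Star (Adjacent (Solutions (suc d) A b)) corners z →
      z ≡ displaced (j List.∷ S) → ⊥
    go nil eq = c≢y eq
    go (_◅_ {j = w} (_ , w∈ , differ) _) _ = neighbour∉ w differ w∈

-- Matrices without eliminable columns

<-absorb₁ : ∀ {x p} → 0ℝ < p → x < x + (p + 0ℝ)
<-absorb₁ {x} {p} = <-absorb {x} {0ℝ} {p} {x + (p + 0ℝ)}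
  (λ n → regroup (seq x n) (seq p n)) (≤-refl {0ℝ})
  where
  regroup : ∀ x p → x ℚ.+ (p ℚ.+ 0ℚ) ≡ x ℚ.+ (0ℚ ℚ.+ p)
  regroup = solve 2 (λ x p → x :+ (p :+ con 0ℚ) := x :+ (con 0ℚ :+ p)) refl

<-absorb₂ : ∀ {x p} → 0ℝ < p → x < p + (x + 0ℝ)
<-absorb₂ {x} {p} = <-absorb {x} {0ℝ} {p} {p + (x + 0ℝ)}
  (λ n → regroup (seq x n) (seq p n)) (≤-refl {0ℝ})
  where
  regroup : ∀ x p → p ℚ.+ (x ℚ.+ 0ℚ) ≡ x ℚ.+ (0ℚ ℚ.+ p)
  regroup = solve 2 (λ x p → p :+ (x :+ con 0ℚ) := x :+ (con 0ℚ :+ p)) refl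

signed-zero : ∀ s {x} → x ≈ 0ℝ → 0ℝ ≤ᴿ signed s x
signed-zero true {x} x≈0 = ≤-trans {0ℝ} {x} {signed true x} (≈⇒≥ {x} {0ℝ} x≈0)
  (≤-reflexive {x} {signed true x} λ n → sym (ℚ.*-identityˡ (seq x n)))
signed-zero false {x} x≈0 = 0≤neg {x} (≈⇒≤ {x} {0ℝ} x≈0)

<⇒≉ : ∀ {x} → x < 0ℝ → ¬ x ≈ 0ℝ
<⇒≉ {x} x<0 x≈0 = <⇒≱ {x} {0ℝ} x<0 (≈⇒≥ {x} {0ℝ} x≈0)

>⇒≉ : ∀ {x} → 0ℝ < x → ¬ x ≈ 0ℝ
>⇒≉ {x} 0<x x≈0 = <⇒≱ {0ℝ} {x} 0<x (≈⇒≤ {x} {0ℝ} x≈0)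

opposite-≉ˡ : ∀ {x y} → Opposite x y → ¬ x ≈ 0ℝ
opposite-≉ˡ {x} (-+ x<0 _) = <⇒≉ {x} x<0
opposite-≉ˡ {x} (+- 0<x _) = >⇒≉ {x} 0<x

opposite-≉ʳ : ∀ {x y} → Opposite x y → ¬ y ≈ 0ℝ
opposite-≉ʳ {y = y} (-+ _ 0<y) = >⇒≉ {y} 0<y
opposite-≉ʳ {y = y} (+- _ y<0) = <⇒≉ {y} y<0

opposite-sym : ∀ {x y} → Opposite x y → Opposite y x
opposite-sym (-+ x<0 0<y) = +- 0<y x<0
opposite-sym (+- 0<x y<0) = -+ y<0 0<x

-- Classical case distinctions on signs and maxima

module Classical (em : ExcludedMiddle 0ℓ) where

  negative? : ∀ x → Dec (x < 0ℝ)
  negative? x = em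

  nonzero-sign : ∀ x → ¬ x ≈ 0ℝ → x < 0ℝ ⊎ 0ℝ < x
  nonzero-sign x x≉0 = go em em
    where
    go : Dec (x < 0ℝ) → Dec (0ℝ < x) → x < 0ℝ ⊎ 0ℝ < x
    go (yes x<0) _         = inj₁ x<0
    go (no x≮0)  (yes 0<x) = inj₂ 0<x
    go (no x≮0)  (no 0≮x)  =
      ⊥-elim (x≉0 (≤-antisym {x} {0ℝ} (≮⇒≥ {0ℝ} {x} 0≮x) (≮⇒≥ {x} {0ℝ} x≮0)))

  -- The sign that makes a nonzero x negative.
  side : ℝ → Bool
  side x = does (negative? x)

  side-neg : ∀ {x} → x < 0ℝ → side x ≡ true
  side-neg {x} x<0 = dec-true (negative? x) x<0

  side-pos : ∀ {x} → 0ℝ < x → side x ≡ false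
  side-pos {x} 0<x = dec-false (negative? x) (λ x<0 → <⇒≱ {x} {0ℝ} x<0 (<⇒≤ {0ℝ} {x} 0<x))

  signed-side-neg : ∀ x → ¬ x ≈ 0ℝ → signed (side x) x < 0ℝ
  signed-side-neg x x≉0 = go (nonzero-sign x x≉0)
    where
    go : x < 0ℝ ⊎ 0ℝ < x → signed (side x) x < 0ℝ
    go (inj₁ x<0) = subst (λ s → signed s x < 0ℝ) (sym (side-neg {x} x<0)) (pos-neg⇒neg {x} x<0)
    go (inj₂ 0<x) = subst (λ s → signed s x < 0ℝ) (sym (side-pos {x} 0<x)) (neg-pos⇒neg {x} 0<x)

  signed-side-pos : ∀ {x y} → Opposite x y → 0ℝ < signed (side x) y
  signed-side-pos {x} {y} (-+ x<0 0<y) =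
    subst (λ s → 0ℝ < signed s y) (sym (side-neg {x} x<0)) (pos-pos⇒pos {y} 0<y)
  signed-side-pos {x} {y} (+- 0<x y<0) =
    subst (λ s → 0ℝ < signed s y) (sym (side-pos {x} 0<x)) (neg-neg⇒pos {y} y<0)

  side-opposite : ∀ {x y} → Opposite x y → side y ≡ not (side x)
  side-opposite {x} {y} (-+ x<0 0<y) =
    trans (side-pos {y} 0<y) (cong not (sym (side-neg {x} x<0)))
  side-opposite {x} {y} (+- 0<x y<0) =
    trans (side-neg {y} y<0) (cong not (sym (side-pos {x} 0<x)))

  -- Recursion on the columns: excluded middle decides whether the tail still meets `P` and whether
  -- column `zero` beats its maximum.
  argmax : ∀ {n} (P : Fin n → Set) (g : Fin n → ℝ) → ∃[ j ] P j →
    ∃[ j ] P j × (∀ l → P l → g l ≤ᴿ g j)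
  argmax {suc n} P g (z , pz) = go em
    where
    Result : Set
    Result = ∃[ j ] P j × (∀ l → P l → g l ≤ᴿ g j)
    compare : ∀ j → P (suc j) → (∀ l → P (suc l) → g (suc l) ≤ᴿ g (suc j)) → P zero →
      Dec (g (suc j) < g zero) → Result
    compare j pj max p₀ (yes lt) = zero , p₀ , λ where
      zero    _  → ≤-refl {g zero}
      (suc l) pl → ≤-trans {g (suc l)} {g (suc j)} {g zero} (max l pl) (<⇒≤ {g (suc j)} {g zero} lt)
    compare j pj max p₀ (no ¬lt) = suc j , pj , λ where
      zero    _  → ≮⇒≥ {g (suc j)} {g zero} ¬lt
      (suc l) pl → max l pl
    extend : ∃[ j ] P (suc j) × (∀ l → P (suc l) → g (suc l) ≤ᴿ g (suc j)) → Dec (P zero) → Result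
    extend (j , pj , max) (yes p₀) = compare j pj max p₀ em
    extend (j , pj , max) (no ¬p₀) = suc j , pj , λ where
      zero    p₀ → ⊥-elim (¬p₀ p₀)
      (suc l) pl → max l pl
    only-zero : ∀ z → P z → ¬ (∃[ j ] P (suc j)) → Result
    only-zero zero    pz none = zero , pz , λ where
      zero    _  → ≤-refl {g zero}
      (suc l) pl → ⊥-elim (none (l , pl))
    only-zero (suc z) pz none = ⊥-elim (none (z , pz))
    go : Dec (∃[ j ] P (suc j)) → Result
    go (yes tail) = extend (argmax (λ j → P (suc j)) (λ j → g (suc j)) tail) em
    go (no none)  = only-zero z pz none

-- Two columns with opposite signs in the same two rows

module Pair (em : ExcludedMiddle 0ℓ) {d m n : ℕ} {A : Matrix m (Fin n)}
  (connected : AlwaysConnected (suc d) A) where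
  open Classical em

  -- The column is oriented so that a nonzero entry of row `r` becomes negative.
  oriented : Fin m → Fin n → Fin m → ℝ
  oriented r j i = signed (side (A r j)) (A i j)

  -- Column j is blocked by row r, column k by row s, any other column l by row g l.
  blocked-pair : ∀ {j k r s t} → j ≢ k →
    Opposite (A r j) (A s j) → Opposite (A r k) (A s k) →
    0ℝ ≤ᴿ oriented r j t + (oriented s k t + 0ℝ) → (g : Fin n → Fin m) →
    (∀ l → l ≢ j → l ≢ k → ¬ A (g l) l ≈ 0ℝ) →
    (∀ l → l ≢ j → l ≢ k → t ≡ g l ⊎ r ≡ g l × oriented r l r ≤ᴿ oriented r j r) → ⊥
  blocked-pair {j} {k} {r} {s} {t} j≢k opp-j opp-k 0≤t g nonzero other =
    isolated em connected {j} {k ∷ []} ((j≢k All.∷ All.[]) AllPairs.∷ All.[] AllPairs.∷ AllPairs.[])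
      f (λ l → signed-side-neg (A (f l) l) (f-nonzero l (l ≟ j) (l ≟ k)))
      (λ l → below l (l ≟ j) (l ≟ k))
    where
    f : Fin n → Fin m
    f l = if does (l ≟ j) then r else if does (l ≟ k) then s else g l
    open Isolation {d} A (λ l → side (A (f l) l)) using (isolated; toward; total)
    f-j : r ≡ f j
    f-j = cong (λ b → if b then r else if does (j ≟ k) then s else g j)
      (sym (dec-true (j ≟ j) refl))
    f-k : s ≡ f k
    f-k = cong₂ (λ b c → if b then r else if c then s else g k)
      (sym (dec-false (k ≟ j) (λ eq → j≢k (sym eq)))) (sym (dec-true (k ≟ k) refl))
    f-other : ∀ {l} → l ≢ j → l ≢ k → g l ≡ f l
    f-other {l} l≢j l≢k = cong₂ (λ b c → if b then r else if c then s else g l)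
      (sym (dec-false (l ≟ j) l≢j)) (sym (dec-false (l ≟ k) l≢k))
    f-nonzero : ∀ l → Dec (l ≡ j) → Dec (l ≡ k) → ¬ A (f l) l ≈ 0ℝ
    f-nonzero l (yes refl) _ = subst (λ i → ¬ A i j ≈ 0ℝ) f-j (opposite-≉ˡ opp-j)
    f-nonzero l (no _) (yes refl) = subst (λ i → ¬ A i k ≈ 0ℝ) f-k (opposite-≉ʳ opp-k)
    f-nonzero l (no l≢j) (no l≢k) =
      subst (λ i → ¬ A i l ≈ 0ℝ) (f-other l≢j l≢k) (nonzero l l≢j l≢k)
    -- The rows are arguments because `f j` and `f k` equal `r` and `s` only propositionally;
    -- `transport` exchanges them.
    Below : Fin m → Fin m → Fin m → Fin n → Set
    Below i r s l = oriented i l i < oriented r j i + (oriented s k i + 0ℝ)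
    transport : ∀ {i i′ r r′ s s′ l} → i ≡ i′ → r ≡ r′ → s ≡ s′ → Below i r s l → Below i′ r′ s′ l
    transport refl refl refl h = h
    -- In column `k`, row `r` is opposite to the blocking row `s`, so the second summand is positive
    -- and the sum exceeds the first.
    below-r : ∀ l → oriented r l r ≤ᴿ oriented r j r → Below r r s l
    below-r l le = ≤-<-trans
      {oriented r l r} {oriented r j r} {oriented r j r + (oriented s k r + 0ℝ)} le
      (<-absorb₁ {oriented r j r} {oriented s k r} (signed-side-pos (opposite-sym opp-k)))
    below-t : ∀ l → ¬ A t l ≈ 0ℝ → Below t r s l
    below-t l ≉0 = <-≤-trans
      {oriented t l t} {0ℝ} {oriented r j t + (oriented s k t + 0ℝ)} (signed-side-neg (A t l) ≉0) 0≤t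
    below-other : ∀ l → l ≢ j → l ≢ k →
      t ≡ g l ⊎ r ≡ g l × oriented r l r ≤ᴿ oriented r j r → Below (g l) r s l
    below-other l l≢j l≢k (inj₁ eq) = transport eq refl refl
      (below-t l (subst (λ i → ¬ A i l ≈ 0ℝ) (sym eq) (nonzero l l≢j l≢k)))
    below-other l l≢j l≢k (inj₂ (eq , le)) = transport eq refl refl (below-r l le)
    below : ∀ l → Dec (l ≡ j) → Dec (l ≡ k) → Below (f l) (f j) (f k) l
    below l (yes refl) _ = transport f-j f-j f-k (below-r j (≤-refl {oriented r j r}))
    below l (no _) (yes refl) = transport f-k f-j f-k
      (<-absorb₂ {oriented s k s} {oriented r j s} (signed-side-pos opp-j))
    below l (no l≢j) (no l≢k) = transport (f-other l≢j l≢k) f-j f-k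
      (below-other l l≢j l≢k (other l l≢j l≢k))

  -- Exchanging the roles of j and k negates both sums of row t, so one of
  -- the two choices of blocking rows makes the sum nonnegative.
  pair-third-row : ∀ {j k r s t} → j ≢ k →
    Opposite (A r j) (A s j) → Opposite (A r k) (A s k) →
    (∀ l → l ≢ j → l ≢ k → ¬ A t l ≈ 0ℝ) → ⊥
  pair-third-row {j} {k} {r} {s} {t} j≢k opp-j opp-k nonzero = go em
    where
    S S′ : ℝ
    S  = oriented r j t + (oriented s k t + 0ℝ)
    S′ = oriented r k t + (oriented s j t + 0ℝ)
    negated : ∀ n → seq (signed false S) n ≡ seq S′ n
    -- Opposite entries orient a column in opposite ways, so exchanging the rows that block `j` and
    -- `k` flips both signs.
    negated n = exchange (side (A r j)) (side (A s k)) (side (A r k)) (side (A s j))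
        (seq (A t j) n) (seq (A t k) n)
        (side-opposite (opposite-sym opp-k)) (side-opposite opp-j)
      where
      sign-not : ∀ b → sign (not b) ≡ ℚ.- sign b
      sign-not true  = refl
      sign-not false = refl
      regroup : ∀ a b p q → ℚ.- 1ℚ ℚ.* (a ℚ.* p ℚ.+ (b ℚ.* q ℚ.+ 0ℚ)) ≡
        ℚ.- b ℚ.* q ℚ.+ (ℚ.- a ℚ.* p ℚ.+ 0ℚ)
      regroup = solve 4 (λ a b p q → con (ℚ.- 1ℚ) :* (a :* p :+ (b :* q :+ con 0ℚ)) :=
        :- b :* q :+ (:- a :* p :+ con 0ℚ)) refl
      exchange : ∀ a b a′ b′ p q → a′ ≡ not b → b′ ≡ not a →
        ℚ.- 1ℚ ℚ.* (sign a ℚ.* p ℚ.+ (sign b ℚ.* q ℚ.+ 0ℚ)) ≡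
        sign a′ ℚ.* q ℚ.+ (sign b′ ℚ.* p ℚ.+ 0ℚ)
      exchange a b _ _ p q refl refl = trans (regroup (sign a) (sign b) p q)
        (cong₂ (λ u v → u ℚ.* q ℚ.+ (v ℚ.* p ℚ.+ 0ℚ))
          {ℚ.- sign b} {sign (not b)} {ℚ.- sign a} {sign (not a)}
          (sym (sign-not b)) (sym (sign-not a)))
    go : Dec (S < 0ℝ) → ⊥
    go (no S≮0) = blocked-pair j≢k opp-j opp-k (≮⇒≥ {S} {0ℝ} S≮0) (λ _ → t)
      nonzero (λ _ _ _ → inj₁ refl)
    go (yes S<0) = blocked-pair (λ eq → j≢k (sym eq)) opp-k opp-j
      (≤-trans {0ℝ} {signed false S} {S′}
        (<⇒≤ {0ℝ} {signed false S} (neg-neg⇒pos {S} S<0))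
        (≤-reflexive {signed false S} {S′} negated))
      (λ _ → t) (λ l l≢k l≢j → nonzero l l≢j l≢k) (λ _ _ _ → inj₁ refl)

  -- By the last hypothesis, rows `r` and `s` are opposite in every column where row `t` is zero. If
  -- there is at most one such column, the pair is chosen to contain it and row `t` blocks the rest.
  -- Otherwise two of these columns form the pair, the sum in row `t` is zero, and row `r` blocks
  -- the remaining ones.
  two-opposite-columns : ∀ {j k r s t} → j ≢ k →
    Opposite (A r j) (A s j) → Opposite (A r k) (A s k) →
    (∀ l → Opposite (A r l) (A s l) ⊎ ¬ A t l ≈ 0ℝ) → ⊥
  two-opposite-columns {j₀} {k₀} {r} {s} {t} j₀≢k₀ opp-j₀ opp-k₀ cover = go em
    where
    Z : Fin n → Set
    Z l = A t l ≈ 0ℝ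
    opposite-Z : ∀ {l} → Z l → Opposite (A r l) (A s l)
    opposite-Z {l} z = [ (λ opp → opp) , (λ ≉0 → ⊥-elim (≉0 z)) ]′ (cover l)
    -- j has the smallest absolute value in row r among the columns in Z, so
    -- row r can block all columns in Z except k.
    two-zeros : ∀ j → Z j → (∀ l → Z l → oriented r l r ≤ᴿ oriented r j r) →
      ∀ k → Z k → k ≢ j → ⊥
    two-zeros j zj max k zk k≢j = blocked-pair {j} {k} {r} {s} {t} (λ eq → k≢j (sym eq))
      (opposite-Z zj) (opposite-Z zk)
      (≤-trans {0ℝ} {0ℝ + (0ℝ + 0ℝ)} {oriented r j t + (oriented s k t + 0ℝ)}
        (≤-reflexive {0ℝ} {0ℝ + (0ℝ + 0ℝ)} λ _ → refl)
        (+-mono-≤ {0ℝ} {oriented r j t} {0ℝ + 0ℝ} {oriented s k t + 0ℝ}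
          (signed-zero (side (A r j)) {A t j} zj)
          (+-mono-≤ {0ℝ} {oriented s k t} {0ℝ} {0ℝ}
            (signed-zero (side (A s k)) {A t k} zk) (≤-refl {0ℝ}))))
      (λ l → row (zero? l)) (λ l _ _ → row-nonzero l (zero? l)) (λ l _ _ → row-choice l (zero? l))
      where
      zero? : ∀ l → Dec (Z l)
      zero? l = em
      row : ∀ {l} → Dec (Z l) → Fin m
      row (yes _) = r
      row (no _)  = t
      row-nonzero : ∀ l (z? : Dec (Z l)) → ¬ A (row z?) l ≈ 0ℝ
      row-nonzero l (yes z) = opposite-≉ˡ (opposite-Z z)
      row-nonzero l (no ¬z) = ¬z
      row-choice : ∀ l (z? : Dec (Z l)) → t ≡ row z? ⊎ r ≡ row z? × oriented r l r ≤ᴿ oriented r j r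
      row-choice l (yes z) = inj₂ (refl , max l z)
      row-choice l (no ¬z) = inj₁ refl
    -- `j` is the only zero of row `t`; if it is not `j₀`, it takes the place of `k₀` in the pair.
    one-zero : ∀ j → Z j → ¬ (∃[ k ] Z k × k ≢ j) → Dec (j₀ ≡ j) → ⊥
    one-zero j zj none (yes refl) = pair-third-row {t = t} j₀≢k₀ opp-j₀ opp-k₀
      (λ l l≢j _ zl → none (l , zl , l≢j))
    one-zero j zj none (no j₀≢j) = pair-third-row {t = t} j₀≢j opp-j₀ (opposite-Z zj)
      (λ l _ l≢j zl → none (l , zl , l≢j))
    some-zero : ∀ j → Z j → (∀ l → Z l → oriented r l r ≤ᴿ oriented r j r) →
      Dec (∃[ k ] Z k × k ≢ j) → ⊥
    some-zero j zj max (yes (k , zk , k≢j)) = two-zeros j zj max k zk k≢j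
    some-zero j zj max (no none) = one-zero j zj none (j₀ ≟ j)
    go : Dec (∃[ l ] Z l) → ⊥
    go (no none) = pair-third-row {t = t} j₀≢k₀ opp-j₀ opp-k₀ (λ l _ _ zl → none (l , zl))
    go (yes some) = let j , zj , max = argmax Z (λ l → oriented r l r) some in
      some-zero j zj max em

-- Cyclic order on three indices

next : Fin 3 → Fin 3
next zero             = suc zero
next (suc zero)       = suc (suc zero)
next (suc (suc zero)) = zero

next-cyclic : ∀ v → next (next (next v)) ≡ v
next-cyclic zero             = refl
next-cyclic (suc zero)       = refl
next-cyclic (suc (suc zero)) = refl

next≢ : ∀ v → next v ≢ v
next≢ zero             ()
next≢ (suc zero)       ()
next≢ (suc (suc zero)) ()

position : ∀ u v → u ≡ v ⊎ u ≡ next v ⊎ u ≡ next (next v)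
position zero             zero             = inj₁ refl
position zero             (suc zero)       = inj₂ (inj₂ refl)
position zero             (suc (suc zero)) = inj₂ (inj₁ refl)
position (suc zero)       zero             = inj₂ (inj₁ refl)
position (suc zero)       (suc zero)       = inj₁ refl
position (suc zero)       (suc (suc zero)) = inj₂ (inj₂ refl)
position (suc (suc zero)) zero             = inj₂ (inj₂ refl)
position (suc (suc zero)) (suc zero)       = inj₂ (inj₁ refl)
position (suc (suc zero)) (suc (suc zero)) = inj₁ refl

module Stuck (em : ExcludedMiddle 0ℓ) {d m n : ℕ} {A : Matrix m (Fin n)}
  (connected : AlwaysConnected (suc d) A) (stuck : ∀ j → ¬ CanBeEliminatedAt A j) where
  open Classical em
  open Pair em {d} {m} {n} {A} connected

  -- The failure of alternative (i) of elimination at `j`, turned into a witness by excluded middle.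
  blocking-positive : ∀ j → ∃[ i ] ∃[ j′ ] 0ℝ < A i j × j′ ≢ j × ¬ A i j′ ≈ 0ℝ
  blocking-positive j = go em
    where
    Witness : Set
    Witness = ∃[ i ] ∃[ j′ ] 0ℝ < A i j × j′ ≢ j × ¬ A i j′ ≈ 0ℝ
    go : Dec Witness → Witness
    go (yes w)   = w
    go (no none) = ⊥-elim (stuck j (inj₁ λ i pos j′ j′≢j →
      decidable-stable em λ ≉0 → none (i , j′ , pos , j′≢j , ≉0)))

  blocking-negative : ∀ j → ∃[ i ] ∃[ j′ ] A i j < 0ℝ × j′ ≢ j × ¬ A i j′ ≈ 0ℝ
  blocking-negative j = go em
    where
    Witness : Set
    Witness = ∃[ i ] ∃[ j′ ] A i j < 0ℝ × j′ ≢ j × ¬ A i j′ ≈ 0ℝ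
    go : Dec Witness → Witness
    go (yes w)   = w
    go (no none) = ⊥-elim (stuck j (inj₂ λ i neg j′ j′≢j →
      decidable-stable em λ ≉0 → none (i , j′ , neg , j′≢j , ≉0)))

  -- Used with n = 2, where the two blocking rows of a column have a nonzero
  -- entry in the other column.
  few-columns : ∀ j k → j ≢ k → (∀ l → l ≡ j ⊎ l ≡ k) → ⊥
  few-columns j k j≢k all = go (blocking-positive j) (blocking-negative j)
      (blocking-positive k) (blocking-negative k)
    where
    other-than-j : ∀ {l} → l ≢ j → l ≡ k
    other-than-j {l} l≢j = [ (λ eq → ⊥-elim (l≢j eq)) , (λ eq → eq) ]′ (all l)
    other-than-k : ∀ {l} → l ≢ k → l ≡ j
    other-than-k {l} l≢k = [ (λ eq → eq) , (λ eq → ⊥-elim (l≢k eq)) ]′ (all l)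
    opposite-rows : ∀ {r s} → Opposite (A r j) (A s j) → Opposite (A r k) (A s k) → ⊥
    -- Every column is `j` or `k`, so no column needs row `t` and any row can be passed for it.
    opposite-rows {r} {s} opp-j opp-k = two-opposite-columns {t = r} j≢k opp-j opp-k λ l →
      [ (λ { refl → inj₁ opp-j }) , (λ { refl → inj₁ opp-k }) ]′ (all l)
    go : (∃[ i ] ∃[ j′ ] 0ℝ < A i j × j′ ≢ j × ¬ A i j′ ≈ 0ℝ) →
         (∃[ i ] ∃[ j′ ] A i j < 0ℝ × j′ ≢ j × ¬ A i j′ ≈ 0ℝ) →
         (∃[ i ] ∃[ j′ ] 0ℝ < A i k × j′ ≢ k × ¬ A i j′ ≈ 0ℝ) →
         (∃[ i ] ∃[ j′ ] A i k < 0ℝ × j′ ≢ k × ¬ A i j′ ≈ 0ℝ) → ⊥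
    go (p , p′ , pj>0 , p′≢j , p≉0) (q , q′ , qj<0 , q′≢j , q≉0)
       (u , u′ , uk>0 , u′≢k , u≉0) (v , v′ , vk<0 , v′≢k , v≉0) =
      signs (nonzero-sign (A p k) (subst (λ l → ¬ A p l ≈ 0ℝ) (other-than-j p′≢j) p≉0))
            (nonzero-sign (A q k) (subst (λ l → ¬ A q l ≈ 0ℝ) (other-than-j q′≢j) q≉0))
            (nonzero-sign (A u j) (subst (λ l → ¬ A u l ≈ 0ℝ) (other-than-k u′≢k) u≉0))
            (nonzero-sign (A v j) (subst (λ l → ¬ A v l ≈ 0ℝ) (other-than-k v′≢k) v≉0))
      where
      -- Rows `p` and `q` are opposite in column `j`. If they agree in column `k`, then `u` or `v`
      -- has the other sign there, and its nonzero entry in column `j` is opposite to that of `p` or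
      -- `q`.
      signs : A p k < 0ℝ ⊎ 0ℝ < A p k → A q k < 0ℝ ⊎ 0ℝ < A q k →
              A u j < 0ℝ ⊎ 0ℝ < A u j → A v j < 0ℝ ⊎ 0ℝ < A v j → ⊥
      signs (inj₁ pk<0) (inj₂ qk>0) _ _ = opposite-rows {p} {q} (+- pj>0 qj<0) (-+ pk<0 qk>0)
      signs (inj₂ pk>0) (inj₁ qk<0) _ _ = opposite-rows {p} {q} (+- pj>0 qj<0) (+- pk>0 qk<0)
      signs (inj₂ pk>0) (inj₂ qk>0) _ (inj₁ vj<0) =
        opposite-rows {p} {v} (+- pj>0 vj<0) (+- pk>0 vk<0)
      signs (inj₂ pk>0) (inj₂ qk>0) _ (inj₂ vj>0) =
        opposite-rows {q} {v} (-+ qj<0 vj>0) (+- qk>0 vk<0)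
      signs (inj₁ pk<0) (inj₁ qk<0) (inj₁ uj<0) _ =
        opposite-rows {p} {u} (+- pj>0 uj<0) (-+ pk<0 uk>0)
      signs (inj₁ pk<0) (inj₁ qk<0) (inj₂ uj>0) _ =
        opposite-rows {q} {u} (-+ qj<0 uj>0) (-+ qk<0 uk>0)

  -- At most three rows

  module ThreeRows (ρ : Fin 3 → Fin m) (surjective : ∀ i → ∃[ v ] ρ v ≡ i) where

    -- A pair of rows is named by the index `v` that it omits.
    OppositeAt : Fin 3 → Fin n → Set
    OppositeAt v l = Opposite (A (ρ (next v)) l) (A (ρ (next (next v))) l)

    -- A column that cannot be eliminated has a positive and a negative entry; their two rows form
    -- the pair.
    opposite-somewhere : ∀ l → ∃[ v ] OppositeAt v l
    opposite-somewhere l =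
      rows (blocking-positive l .proj₂ .proj₂ .proj₁) (blocking-negative l .proj₂ .proj₂ .proj₁)
        (surjective (blocking-positive l .proj₁)) (surjective (blocking-negative l .proj₁))
      where
      at : ∀ u v → 0ℝ < A (ρ u) l → A (ρ v) l < 0ℝ →
        u ≡ v ⊎ u ≡ next v ⊎ u ≡ next (next v) → ∃[ w ] OppositeAt w l
      at u .u pos neg (inj₁ refl) = ⊥-elim (<⇒≱ {0ℝ} {A (ρ u) l} pos (<⇒≤ {A (ρ u) l} {0ℝ} neg))
      at .(next v) v pos neg (inj₂ (inj₁ refl)) = next (next v) ,
        subst₂ (λ a b → Opposite (A (ρ a) l) (A (ρ b) l))
          (sym (next-cyclic v)) (sym (cong next (next-cyclic v))) (-+ neg pos)
      at .(next (next v)) v pos neg (inj₂ (inj₂ refl)) = next v ,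
        subst (λ b → Opposite (A (ρ (next (next v))) l) (A (ρ b) l))
          (sym (next-cyclic v)) (+- pos neg)
      rows : ∀ {i i′} → 0ℝ < A i l → A i′ l < 0ℝ → ∃[ v ] ρ v ≡ i → ∃[ v ] ρ v ≡ i′ →
        ∃[ w ] OppositeAt w l
      rows pos neg (u , refl) (v , refl) = at u v pos neg (position u v)

    nonzero-elsewhere : ∀ {v w l} → OppositeAt w l → v ≢ w → ¬ A (ρ v) l ≈ 0ℝ
    nonzero-elsewhere {v} {w} {l} opp v≢w = go (position v w)
      where
      go : v ≡ w ⊎ v ≡ next w ⊎ v ≡ next (next w) → ¬ A (ρ v) l ≈ 0ℝ
      go (inj₁ eq)          = ⊥-elim (v≢w eq)
      go (inj₂ (inj₁ refl)) = opposite-≉ˡ opp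
      go (inj₂ (inj₂ refl)) = opposite-≉ʳ opp

    -- Take `t = ρ v`: in a column where another pair is opposite, row `v` belongs to that pair and
    -- is nonzero.
    opposite-unique : ∀ {v j k} → OppositeAt v j → OppositeAt v k → j ≡ k
    opposite-unique {v} {j} {k} opp-j opp-k = decidable-stable (j ≟ k) λ j≢k →
      two-opposite-columns {t = ρ v} j≢k opp-j opp-k λ l →
        cover l (opposite-somewhere l .proj₁ ≟ v) (opposite-somewhere l .proj₂)
      where
      cover : ∀ l {w} → Dec (w ≡ v) → OppositeAt w l → OppositeAt v l ⊎ ¬ A (ρ v) l ≈ 0ℝ
      cover l (yes refl) opp = inj₁ opp
      cover l (no w≢v)   opp = inj₂ (nonzero-elsewhere {v} {_} {l} opp (λ eq → w≢v (sym eq)))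

    index : Fin n → Fin 3
    index l = opposite-somewhere l .proj₁

    index-opposite : ∀ l → OppositeAt (index l) l
    index-opposite l = opposite-somewhere l .proj₂

    index-injective : ∀ {j k} → index j ≡ index k → j ≡ k
    index-injective {j} {k} eq = opposite-unique {index j} (index-opposite j)
      (subst (λ v → OppositeAt v k) (sym eq) (index-opposite k))

    -- In the remaining case the matrix is 3 × 3 and, up to the order of the
    -- columns and positive factors, cyclic with rows (0,+,−), (−,0,+), (+,−,0)
    -- after changing the signs of columns.
    module Cyclic (column : Fin 3 → Fin n) (index-column : ∀ v → index (column v) ≡ v) where

      opposite-column : ∀ v → OppositeAt v (column v)
      opposite-column v =
        subst (λ w → OppositeAt w (column v)) (index-column v) (index-opposite (column v))

      column-distinct : ∀ {u v} → u ≢ v → column u ≢ column v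
      column-distinct {u} {v} u≢v eq =
        u≢v (trans (sym (index-column u)) (trans (cong index eq) (index-column v)))

      -- Otherwise column `v` would be opposite in a second pair of rows, which by `opposite-unique`
      -- belongs to another column.
      diagonal-zero : ∀ v → A (ρ v) (column v) ≈ 0ℝ
      diagonal-zero v = decidable-stable em λ ≉0 → go (opposite-column v) (nonzero-sign (A (ρ v) (column v)) ≉0)
        where
        c = column v
        -- a third nonzero entry has the sign opposite to one of the other two
        at-next : Opposite (A (ρ (next (next v))) c) (A (ρ v) c) → ⊥
        at-next opp = next≢ v (sym (trans (sym (index-column v))
          (trans (cong index (opposite-unique {next v}
            (subst (λ u → Opposite (A (ρ (next (next v))) c) (A (ρ u) c)) (sym (next-cyclic v)) opp)
            (opposite-column (next v)))) (index-column (next v)))))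
        at-next² : Opposite (A (ρ v) c) (A (ρ (next v)) c) → ⊥
        at-next² opp = column-distinct {v} {next (next v)}
          (λ eq → next≢ v (trans (cong next eq) (next-cyclic v)))
          (opposite-unique {next (next v)}
            (subst₂ (λ a b → Opposite (A (ρ a) c) (A (ρ b) c))
              (sym (next-cyclic v)) (sym (cong next (next-cyclic v))) opp)
            (opposite-column (next (next v))))
        go : OppositeAt v c → A (ρ v) c < 0ℝ ⊎ 0ℝ < A (ρ v) c → ⊥
        go (-+ y<0 z>0) (inj₁ x<0) = at-next (+- z>0 x<0)
        go (-+ y<0 z>0) (inj₂ x>0) = at-next² (+- x>0 y<0)
        go (+- y>0 z<0) (inj₁ x<0) = at-next² (-+ x<0 y>0)
        go (+- y>0 z<0) (inj₂ x>0) = at-next (-+ z<0 x>0)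

      -- The blocking row follows the omitted one in cyclic order, so it is one of the two opposite
      -- rows of the column.
      f : Fin n → Fin m
      f l = ρ (next (index l))

      open Isolation {d} A (λ l → side (A (f l) l)) using (isolated; toward; total)

      all-columns : List (Fin n)
      all-columns = column zero ∷ column (suc zero) ∷ column (suc (suc zero)) ∷ []

      all-columns-unique : Unique all-columns
      all-columns-unique =
        (column-distinct (λ ()) All.∷ column-distinct (λ ()) All.∷ All.[]) AllPairs.∷
        (column-distinct (λ ()) All.∷ All.[]) AllPairs.∷ All.[] AllPairs.∷ AllPairs.[]

      toward-next : ∀ v → 0ℝ ≤ᴿ toward (ρ (next v)) (column (next v))
      toward-next v = signed-zero (side (A (f (column (next v))) (column (next v))))
        {A (ρ (next v)) (column (next v))} (diagonal-zero (next v))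

      -- The column after next is blocked by row `next (next (next v))`, which is `v`, and its entry
      -- in row `next v` has the opposite sign.
      toward-next² : ∀ v → 0ℝ < toward (ρ (next v)) (column (next (next v)))
      toward-next² v = subst₂
        (λ a b → 0ℝ < signed (side (A (ρ (next a)) c)) (A (ρ b) c))
        (sym (index-column (next (next v)))) (cong next (next-cyclic v))
        (signed-side-pos (opposite-column (next (next v))))
        where c = column (next (next v))

      cyclic-sum₀ : ∀ x y z → x ℚ.+ (y ℚ.+ (z ℚ.+ 0ℚ)) ≡ x ℚ.+ (y ℚ.+ z)
      cyclic-sum₀ = solve 3 (λ x y z → x :+ (y :+ (z :+ con 0ℚ)) := x :+ (y :+ z)) refl

      cyclic-sum₁ : ∀ x y z → z ℚ.+ (x ℚ.+ (y ℚ.+ 0ℚ)) ≡ x ℚ.+ (y ℚ.+ z)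
      cyclic-sum₁ = solve 3 (λ x y z → z :+ (x :+ (y :+ con 0ℚ)) := x :+ (y :+ z)) refl

      cyclic-sum₂ : ∀ x y z → y ℚ.+ (z ℚ.+ (x ℚ.+ 0ℚ)) ≡ x ℚ.+ (y ℚ.+ z)
      cyclic-sum₂ = solve 3 (λ x y z → y :+ (z :+ (x :+ con 0ℚ)) := x :+ (y :+ z)) refl

      -- The sum is rotated so that it can start at any of the three columns.
      seq-total : ∀ v i N → seq (total all-columns i) N ≡
        seq (toward i (column v)) N ℚ.+
          (seq (toward i (column (next v))) N ℚ.+ seq (toward i (column (next (next v)))) N)
      seq-total zero i N = cyclic-sum₀ (seq (toward i (column zero)) N)
        (seq (toward i (column (suc zero))) N) (seq (toward i (column (suc (suc zero)))) N)
      seq-total (suc zero) i N = cyclic-sum₁ (seq (toward i (column (suc zero))) N)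
        (seq (toward i (column (suc (suc zero)))) N) (seq (toward i (column zero)) N)
      seq-total (suc (suc zero)) i N = cyclic-sum₂ (seq (toward i (column (suc (suc zero)))) N)
        (seq (toward i (column zero)) N) (seq (toward i (column (suc zero))) N)

      -- Besides the entry of column `v`, the sum in row `next v` consists of a zero and a positive
      -- entry.
      below : ∀ v → toward (ρ (next v)) (column v) < total all-columns (ρ (next v))
      below v = <-absorb {toward (ρ (next v)) (column v)} {toward (ρ (next v)) (column (next v))}
        {toward (ρ (next v)) (column (next (next v)))} {total all-columns (ρ (next v))}
        (seq-total v (ρ (next v))) (toward-next v) (toward-next² v)

      contradictory : ⊥
      contradictory = isolated em connected all-columns-unique f
        (λ l → signed-side-neg (A (f l) l) (opposite-≉ˡ (index-opposite l)))
        -- Injectivity of `index` identifies every column `l` with `column (index l)`.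
        (λ l → subst (λ k → toward (ρ (next (index l))) k < total all-columns (ρ (next (index l))))
          (index-injective (index-column (index l))) (below (index l)))

    -- Once the missed value is punched out, `index` is an injection into `Fin 2`.
    missed-index : ∀ v → (∀ l → index l ≢ v) → n ≤ 2
    missed-index v missed = Fin.injective⇒≤ {f = λ l → punchOut (v≢ l)}
      (λ {j} {k} eq → index-injective (Fin.punchOut-injective (v≢ j) (v≢ k) eq))
      where
      v≢ : ∀ l → v ≢ index l
      v≢ l eq = missed l (sym eq)

    -- If `index` takes all three values, the cyclic case applies; otherwise there are at most two
    -- columns, a case treated separately.
    three-rows : ⊥ ⊎ n ≤ 2
    three-rows = go em
      where
      go : Dec (∀ v → ∃[ l ] index l ≡ v) → ⊥ ⊎ n ≤ 2
      go (yes column) = inj₁ (Cyclic.contradictory (λ v → column v .proj₁) (λ v → column v .proj₂))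
      go (no ¬all) = inj₂ (decidable-stable (n ℕ.≤? 2) λ n≰2 → ¬all λ v →
        decidable-stable em λ none → n≰2 (missed-index v λ l eq → none (l , eq)))

-- Case analysis on the size and induction on the columns

no-stuck-column : ExcludedMiddle 0ℓ → ∀ {d} m n (A : Matrix m (Fin (suc n))) →
  AlwaysConnected (suc d) A → m ≤ 3 ⊎ suc n ≤ 2 → ¬ (∀ j → ¬ CanBeEliminatedAt A j)
no-stuck-column em {d} m n A connected small stuck = go m n A connected stuck small
  where
  few : ∀ {m} n (A : Matrix m (Fin (suc n))) → AlwaysConnected (suc d) A →
    (∀ j → ¬ CanBeEliminatedAt A j) → suc n ≤ 2 → ⊥
  -- With a single column there is no second column in which a blocking row could be nonzero.
  few zero A connected stuck _ = single (Stuck.blocking-positive em {d} {A = A} connected stuck zero)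
    where
    single : ∃[ i ] ∃[ j′ ] 0ℝ < A i zero × j′ ≢ zero × ¬ A i j′ ≈ 0ℝ → ⊥
    single (_ , zero , _ , 0≢0 , _) = 0≢0 refl
  few (suc zero) A connected stuck _ =
    Stuck.few-columns em {d} {A = A} connected stuck zero (suc zero) (λ ()) λ where
      zero       → inj₁ refl
      (suc zero) → inj₂ refl
  few (suc (suc n)) A connected stuck (s≤s (s≤s ()))
  three : ∀ {m} n (A : Matrix m (Fin (suc n))) → AlwaysConnected (suc d) A →
    (∀ j → ¬ CanBeEliminatedAt A j) → (ρ : Fin 3 → Fin m) → (∀ i → ∃[ v ] ρ v ≡ i) → ⊥
  three n A connected stuck ρ surjective =
    [ (λ c → c) , few n A connected stuck ]′
      (Stuck.ThreeRows.three-rows em {d} {A = A} connected stuck ρ surjective)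
  go : ∀ m n (A : Matrix m (Fin (suc n))) → AlwaysConnected (suc d) A →
    (∀ j → ¬ CanBeEliminatedAt A j) → m ≤ 3 ⊎ suc n ≤ 2 → ⊥
  go m n A connected stuck (inj₂ n≤2) = few n A connected stuck n≤2
  -- Without rows the elimination condition is vacuous.
  go 0 n A connected stuck (inj₁ _) = stuck zero (inj₁ λ ())
  go 1 n A connected stuck (inj₁ _) = three n A connected stuck (λ _ → zero) λ where
    zero → zero , refl
  -- ρ need not be injective: with two rows, one of them is listed twice.
  go 2 n A connected stuck (inj₁ _) = three n A connected stuck
    (λ { zero → zero ; (suc _) → suc zero }) λ where
      zero       → zero , refl
      (suc zero) → suc zero , refl
  go 3 n A connected stuck (inj₁ _) = three n A connected stuck (λ v → v) (λ i → i , refl)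
  go (suc (suc (suc (suc m)))) n A connected stuck (inj₁ (s≤s (s≤s (s≤s ()))))

ordering-exists : ExcludedMiddle 0ℓ → ∀ {d} m n (A : Matrix m (Fin n)) →
  AlwaysConnected (suc d) A → m ≤ 3 ⊎ n ≤ 2 → HasEliminationOrdering A
ordering-exists em m zero A connected small = Perm.id , λ ()
ordering-exists em {d} m (suc n) A connected small = go em
  where
  smaller : m ≤ 3 ⊎ suc n ≤ 2 → m ≤ 3 ⊎ n ≤ 2
  smaller (inj₁ m≤3) = inj₁ m≤3
  smaller (inj₂ n<2) = inj₂ (ℕ.≤-trans (ℕ.n≤1+n n) n<2)
  go : Dec (∃[ j ] CanBeEliminatedAt A j) → HasEliminationOrdering A
  go (yes (j , elim)) = insert-ordering A j elim
    (ordering-exists em {d} m n (remove-column A j)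
      (remove-column-connected em A j elim connected) (smaller small))
  go (no none) = ⊥-elim (no-stuck-column em {d} m n A connected small λ j elim → none (j , elim))

theorem2 : ExcludedMiddle 0ℓ →
    ∀ (d : ℕ) .{{_ : NonZero d}} (m n : ℕ) (A : Matrix m (Fin n)) →
    (∀ (b : Vector ℝ m) → Connected (Solutions d A b)) →
    m ≤ 3 ⊎ n ≤ 2 →
    HasEliminationOrdering A
theorem2 em zero    m n A connected small = ⊥-elim (ℕ.≢-nonZero⁻¹ 0 refl)
theorem2 em (suc d) m n A connected small = ordering-exists em {d} m n A connected small
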